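{- Let $X$ be a finite set equipped with a probability measure $\mu$, and let $\mathcal F\subseteq L^2(\mu)$ be a collection of real-valued functions on $X$ with $\sup_{\varphi\in\mathcal F}\|\varphi\|_\infty\le1$. Then for every $0<\eta<e^{ -3}$ and $f\in\Delta_X$, there is $g\in\Delta_X$ such that: (1) $\|f-g\|_{\mathcal F}\le\eta$; (2) $g$ is a non-negative linear combination of degree-$d$ Riesz $\mathcal F$-products for some \[ d\le 12\,\frac{\mathrm{Ent}_\mu(f)}{\eta} + O\!\left(\frac{\log(1/\eta)}{\log\log(1/\eta)}\right), \] where the implied constant is absolute.
   Context: $\langle f,g\rangle = \sum_{x\in X}\mu(x)f(x)g(x)$, $\mathbb E_\mu h=\sum_x\mu(x)h(x)$, $\|h\|_p = (\mathbb E_\mu|h|^p)^{1/p}$. $\Delta_X = \{f:X\to[0,\infty):\|f\|_1=1\}$; $\mathrm{Ent}_\mu(f)=\mathbb E_\mu[f\log f]$ (with $0\log0=0$); $\|h\|_{\mathcal F} = \sup_{\varphi\in\mathcal F}|\langle\varphi,h\rangle|$. A degree-$d$ Riesz $\mathcal F$-product is a function $R(x)=\prod_{i=1}^d(1+\epsilon_i\varphi_i(x))$ with $d\ge1$, $\varphi_i\in\mathcal F$, $\epsilon_i\in\{ -1,0,1\}$. -}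

module Defs where

open import Algebra.Bundles using (CommutativeRing; Semiring)
open import Algebra.Core using (Op₁; Op₂)
open import Algebra.Structures using (IsCommutativeRing)
import Algebra.Construct.NaturalChoice.Max as Max
import Algebra.Definitions.RawSemiring as SemiringDefinitions
open import Axiom.ExcludedMiddle using (ExcludedMiddle)
open import Data.Fin.Base using (Fin; toℕ)
open import Data.Nat.Base as ℕ using (ℕ; _!)
open import Data.Product.Base using (_×_; ∃; ∃-syntax; proj₁)
open import Data.Sum.Base using (_⊎_)
open import Function.Bundles using (_↔_; Inverse)
open import Level using (0ℓ)
open import Relation.Binary.Bundles using (TotalOrder)
open import Relation.Binary.Core using (Rel)
import Relation.Binary.Construct.NonStrictToStrict as Strict
open import Relation.Binary.Structures using (IsTotalOrder)
open import Relation.Nullary using (¬_; Dec; yes; no)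
open import Relation.Unary using (Pred; _∈_; Satisfiable)

-- The real numbers, given by their axiomatic characterisation: an ordered
-- field in which every inhabited set that is bounded above has a least upper
-- bound. Classically this determines the structure up to unique isomorphism.
record CompleteOrderedField : Set₁ where
  infix  4 _≈_ _≤_
  infixl 6 _+_
  infixl 7 _*_
  infix  8 -_
  field
    Carrier : Set
    _≈_ _≤_ : Rel Carrier 0ℓ
    _+_ _*_ : Op₂ Carrier
    -_      : Op₁ Carrier
    0# 1#   : Carrier

    isCommutativeRing : IsCommutativeRing _≈_ _+_ _*_ -_ 0# 1#
    0≉1               : ¬ (0# ≈ 1#)
    inverse           : ∀ x → ¬ (x ≈ 0#) → ∃[ y ] x * y ≈ 1#

    isTotalOrder : IsTotalOrder _≈_ _≤_
    +-monoˡ-≤    : ∀ z {x y} → x ≤ y → x + z ≤ y + z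
    *-nonNeg     : ∀ {x y} → 0# ≤ x → 0# ≤ y → 0# ≤ x * y

  IsUpperBound : Pred Carrier 0ℓ → Carrier → Set
  IsUpperBound S u = ∀ y → y ∈ S → y ≤ u

  IsLeastUpperBound : Pred Carrier 0ℓ → Carrier → Set
  IsLeastUpperBound S s = IsUpperBound S s × (∀ u → IsUpperBound S u → s ≤ u)

  field
    complete : ∀ S → Satisfiable S → ∃ (IsUpperBound S) → ∃ (IsLeastUpperBound S)

  commutativeRing : CommutativeRing 0ℓ 0ℓ
  commutativeRing = record { isCommutativeRing = isCommutativeRing }

  totalOrder : TotalOrder 0ℓ 0ℓ 0ℓ
  totalOrder = record { isTotalOrder = isTotalOrder }

module Analysis (em : ExcludedMiddle 0ℓ) (reals : CompleteOrderedField) where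

  open CompleteOrderedField reals public
    renaming (Carrier to ℝ)
  open Max totalOrder public using (_⊔_)
  open Strict _≈_ _≤_ public using (_<_)
  open SemiringDefinitions (Semiring.rawSemiring (CommutativeRing.semiring commutativeRing)) public
    using (_^_; sum; product)
    renaming (_×_ to _×ℕ_)

  infixl 6 _-_
  infix  9 _⁻¹

  _-_ : Op₂ ℝ
  x - y = x + (- y)

  fromℕ : ℕ → ℝ
  fromℕ n = n ×ℕ 1#

  ∣_∣ : Op₁ ℝ
  ∣ x ∣ = x ⊔ (- x)

  -- Definite description: a real number satisfying P if there is one, and the
  -- junk value 0 otherwise. It is used only for properties that determine a
  -- real number up to _≈_.
  the : Pred ℝ 0ℓ → ℝ
  the P = choose em
    where
    choose : Dec (∃ P) → ℝ
    choose (yes w) = proj₁ w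
    choose (no _)  = 0#

  _⁻¹ : Op₁ ℝ
  x ⁻¹ = the λ y → x * y ≈ 1#

  -- Meaningful only for inhabited S that are bounded above.
  sup : Pred ℝ 0ℓ → ℝ
  sup S = the (IsLeastUpperBound S)

  IsLimit : (ℕ → ℝ) → ℝ → Set
  IsLimit a L = ∀ ε → 0# < ε → ∃[ N ] (∀ n → N ℕ.≤ n → ∣ a n - L ∣ < ε)

  exp : Op₁ ℝ
  exp t = the (IsLimit λ n → sum {n} λ k → t ^ toℕ k * fromℕ (toℕ k !) ⁻¹)

  -- For x ≤ 0 this is the junk value 0.
  log : Op₁ ℝ
  log x = the λ y → exp y ≈ x

  record FiniteProbabilitySpace : Set₁ where
    field
      X           : Set
      size        : ℕ
      enumeration : Fin size ↔ X
      μ           : X → ℝ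

    ∑ : (X → ℝ) → ℝ
    ∑ h = sum λ i → h (Inverse.to enumeration i)

    field
      μ-nonNeg : ∀ x → 0# ≤ μ x
      μ-total  : ∑ μ ≈ 1#

  module _ (Ω : FiniteProbabilitySpace) where
    open FiniteProbabilitySpace Ω

    𝔼 : (X → ℝ) → ℝ
    𝔼 h = ∑ λ x → μ x * h x

    ⟪_,_⟫ : (X → ℝ) → (X → ℝ) → ℝ
    ⟪ f , g ⟫ = ∑ λ x → μ x * f x * g x

    ‖_‖₁ : (X → ℝ) → ℝ
    ‖ h ‖₁ = 𝔼 λ x → ∣ h x ∣

    -- The maximum over all points of X, including those of measure zero.
    ‖_‖∞ : (X → ℝ) → ℝ
    ‖ h ‖∞ = sup λ y → ∃[ x ] y ≈ ∣ h x ∣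

    -- sup_{φ ∈ F} ‖φ‖∞ ≤ c. The supremum is required to exist, so an unbounded
    -- F does not satisfy this through the junk value of sup.
    SupNormAtMost : Pred (X → ℝ) 0ℓ → ℝ → Set
    SupNormAtMost F c =
      ∃[ s ] IsLeastUpperBound (λ y → ∃[ φ ] φ ∈ F × y ≈ ‖ φ ‖∞) s × s ≤ c

    dualNorm : Pred (X → ℝ) 0ℓ → (X → ℝ) → ℝ
    dualNorm F h = sup λ y → ∃[ φ ] φ ∈ F × y ≈ ∣ ⟪ φ , h ⟫ ∣

    IsDensity : Pred (X → ℝ) 0ℓ
    IsDensity f = (∀ x → 0# ≤ f x) × ‖ f ‖₁ ≈ 1#

    -- Where f x ≈ 0 the summand vanishes whatever log 0 is.
    Ent : (X → ℝ) → ℝ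
    Ent f = 𝔼 λ x → f x * log (f x)

    record IsRieszProduct (F : Pred (X → ℝ) 0ℓ) (d : ℕ) (R : X → ℝ) : Set where
      field
        d≥1    : 1 ℕ.≤ d
        φ      : Fin d → X → ℝ
        φ∈F    : ∀ i → φ i ∈ F
        ε      : Fin d → ℝ
        ε-sign : ∀ i → ε i ≈ - 1# ⊎ ε i ≈ 0# ⊎ ε i ≈ 1#
        R≈∏    : ∀ x → R x ≈ product λ i → 1# + ε i * φ i x

    record IsNonNegCombination (S : Pred (X → ℝ) 0ℓ) (g : X → ℝ) : Set where
      field
        terms    : ℕ
        c        : Fin terms → ℝ
        c-nonNeg : ∀ j → 0# ≤ c j
        R        : Fin terms → X → ℝ
        R∈S      : ∀ j → R j ∈ S
        g≈∑      : ∀ x → g x ≈ sum λ j → c j * R j x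

-- The approximant is g = h(y) / 𝔼 h(y), where h(y) is a multiple of y (3 + y²)ⁿ and
-- y = a + Σᵢ tᵢ (1 + εᵢ φᵢ) with a, tᵢ ≥ 0, so that g is visibly a non-negative
-- combination of Riesz products of degree 2n + 1. Let H be a primitive of h and T = Σᵢ tᵢ.
-- Choose y as a near-maximiser of 𝔼[f y - H(y)] - (5/6) η T under the constraint
-- a + 2T ≤ 2, which keeps 0 ≤ y ≤ 2. If the constraints are not active, the first-order
-- conditions read 𝔼 h(y) ≈ 1 and |⟨φ, f - h(y)⟩| ≤ (17/18) η for φ ∈ F. They are not:
-- the inequality f (y - 1) - (H(y) - H(1)) ≤ κ (f log f - f + 1) with κ = 2/(n + 1),
-- which is Fenchel-Young together with exp u ≤ 1 + u + u² for u = (y - 1)/2, bounds the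
-- maximum and gives (5/6) η T ≤ κ Ent f ≤ η/3, i.e. T ≤ 2/5, once n ≥ 6 Ent f / η.
--
-- Taking the polynomial h instead of the exponential of mirror descent makes a truncated
-- Taylor expansion superfluous; log(1/η) / log log(1/η) only enters as a number ≥ 1.
module Submission where

open import Algebra.Bundles using (CommutativeRing)
import Algebra.Properties.AbelianGroup as AbelianGroupProperties
import Algebra.Properties.CommutativeSemiring.Exp as CommutativeSemiringExp
import Algebra.Properties.Ring as RingProperties
import Algebra.Properties.Semiring.Exp as SemiringExp
import Algebra.Properties.Semiring.Mult as SemiringMult
import Algebra.Properties.Semiring.Sum as SemiringSum
import Algebra.Solver.Ring as RingSolver
open import Algebra.Solver.Ring.AlmostCommutativeRing using (_-Raw-AlmostCommutative⟶_; fromCommutativeRing)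
open import Axiom.ExcludedMiddle using (ExcludedMiddle)
open import Data.Empty using (⊥-elim)
open import Data.Fin.Base using (Fin; zero; suc; toℕ)
open import Data.Integer.Base as ℤ using (ℤ; -[1+_])
import Data.Integer.Properties as ℤ
open import Data.Maybe.Base using (just; nothing)
open import Data.Nat.Base as ℕ using (ℕ; zero; suc; _!)
import Data.Nat.Properties as ℕ
open import Data.Product.Base using (_×_; _,_; ∃; ∃-syntax; proj₁; proj₂)
import Data.Sign.Base as Sign
open import Data.Sum.Base using (_⊎_; inj₁; inj₂; [_,_]′)
open import Data.Vec.Functional using (_∷_)
open import Function.Base using (_∘_)
open import Function.Bundles using (Inverse)
open import Level using (0ℓ)
import Relation.Binary.Construct.NonStrictToStrict as Strict
open import Relation.Binary.Definitions using (WeaklyDecidable)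
import Relation.Binary.PropositionalEquality as ≡
import Relation.Binary.Reasoning.Setoid as SetoidReasoning
open import Relation.Binary.Structures using (IsTotalOrder)
open import Relation.Nullary using (¬_; yes; no)
open import Relation.Unary using (Pred; _∈_; Satisfiable)
open import Defs


-- The factor `3 + y²` is `4 (1 + u + u²)` with `u = (y - 1)/2`. In `u` it majorises `exp` for
-- `u ≤ 1/2`, that is on the whole range `y ≤ 2`; in `y` its coefficients are non-negative. The
-- second property gives non-negative coefficients of the Riesz products, and for its sake `y` is
-- built from the generators `1 + εᵢ φᵢ ≥ 0` and a constant `a ≥ 0`.
--
-- As `F` is arbitrary, the supremum of the objective need not be attained. Derivatives are
-- therefore replaced by steps of a fixed length `δ`, whose quadratic loss is controlled by a
-- constant `M` for `h` on `[0,2]`. This constant depends on `n`, which is harmless: only `δ`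
-- shrinks with it, and `δ` does not enter the degree.
--
-- Errors are counted in units `σ = η/18`: 15 for the price of `T`, 1 for inexact maximisation, 1
-- for passing from `1 + εφ` to `εφ`, and 1 for normalising `h(y)`. The price 15 faces a possible
-- gain of only `6σ`; hence `2T` is about 4/5 at most, which leaves room beside `a ≤ 1 + σ`. The
-- constant `a` is free of charge, so `𝔼 h(y)` is pinned down to within a single `σ`.

-- A ring solver with integer coefficients

module IntegerCoefficientSolver (R : CommutativeRing 0ℓ 0ℓ) where
  open CommutativeRing R
  open SemiringMult semiring renaming (_×_ to _×ℕ_)
  open RingProperties ring
  open AbelianGroupProperties +-abelianGroup using (⁻¹-∙-comm; ε⁻¹≈ε; ⁻¹-involutive)
  open SetoidReasoning setoid

  -- The case of 1 is separate so that con (+ 1) evaluates to 1# itself.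
  ι : ℕ → Carrier
  ι 1 = 1#
  ι n = n ×ℕ 1#

  ι≈× : ∀ n → ι n ≈ n ×ℕ 1#
  ι≈× 0             = refl
  ι≈× 1             = sym (+-identityʳ 1#)
  ι≈× (suc (suc n)) = refl

  ⟦_⟧ : ℤ → Carrier
  ⟦ ℤ.+ n ⟧    = ι n
  ⟦ -[1+ n ] ⟧ = - ι (suc n)

  ⟦⟧-neg : ∀ i → ⟦ ℤ.- i ⟧ ≈ - ⟦ i ⟧
  ⟦⟧-neg (ℤ.+ 0)     = sym ε⁻¹≈ε
  ⟦⟧-neg ℤ.+[1+ n ]  = refl
  ⟦⟧-neg -[1+ n ]    = sym (⁻¹-involutive _)

  ⟦⟧-⊖ : ∀ m n → ⟦ m ℤ.⊖ n ⟧ ≈ m ×ℕ 1# + - (n ×ℕ 1#)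
  ⟦⟧-⊖ m zero = begin
    ι m               ≈⟨ ι≈× m ⟩
    m ×ℕ 1#            ≈⟨ +-identityʳ _ ⟨
    m ×ℕ 1# + 0#       ≈⟨ +-congˡ ε⁻¹≈ε ⟨
    m ×ℕ 1# + - 0#     ∎
  ⟦⟧-⊖ zero (suc n) = begin
    - ι (suc n)               ≈⟨ -‿cong (ι≈× (suc n)) ⟩
    - (suc n ×ℕ 1#)            ≈⟨ +-identityˡ _ ⟨
    0# + - (suc n ×ℕ 1#)       ∎
  ⟦⟧-⊖ (suc m) (suc n) = begin
    ⟦ suc m ℤ.⊖ suc n ⟧                           ≡⟨ ≡.cong ⟦_⟧ (ℤ.[1+m]⊖[1+n]≡m⊖n m n) ⟩
    ⟦ m ℤ.⊖ n ⟧                                   ≈⟨ ⟦⟧-⊖ m n ⟩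
    m ×ℕ 1# + - (n ×ℕ 1#)                           ≈⟨ +-congʳ (+-identityˡ _) ⟨
    0# + m ×ℕ 1# + - (n ×ℕ 1#)                      ≈⟨ +-congʳ (+-congʳ (-‿inverseʳ 1#)) ⟨
    1# + - 1# + m ×ℕ 1# + - (n ×ℕ 1#)               ≈⟨ +-congʳ (+-assoc _ _ _) ⟩
    1# + (- 1# + m ×ℕ 1#) + - (n ×ℕ 1#)             ≈⟨ +-congʳ (+-congˡ (+-comm _ _)) ⟩
    1# + (m ×ℕ 1# + - 1#) + - (n ×ℕ 1#)             ≈⟨ +-congʳ (+-assoc _ _ _) ⟨
    1# + m ×ℕ 1# + - 1# + - (n ×ℕ 1#)               ≈⟨ +-assoc _ _ _ ⟩
    1# + m ×ℕ 1# + (- 1# + - (n ×ℕ 1#))             ≈⟨ +-congˡ (⁻¹-∙-comm _ _) ⟩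
    1# + m ×ℕ 1# + - (1# + n ×ℕ 1#)                 ∎

  ⟦⟧-+ : ∀ i j → ⟦ i ℤ.+ j ⟧ ≈ ⟦ i ⟧ + ⟦ j ⟧
  ⟦⟧-+ (ℤ.+ m) (ℤ.+ n) = begin
    ι (m ℕ.+ n)          ≈⟨ ι≈× (m ℕ.+ n) ⟩
    (m ℕ.+ n) ×ℕ 1#       ≈⟨ ×-homo-+ 1# m n ⟩
    m ×ℕ 1# + n ×ℕ 1#      ≈⟨ +-cong (ι≈× m) (ι≈× n) ⟨
    ι m + ι n            ∎
  ⟦⟧-+ (ℤ.+ m) -[1+ n ] =
    trans (⟦⟧-⊖ m (suc n)) (sym (+-cong (ι≈× m) (-‿cong (ι≈× (suc n)))))
  ⟦⟧-+ -[1+ m ] (ℤ.+ n) =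
    trans (⟦⟧-⊖ n (suc m)) (trans (+-comm _ _) (sym (+-cong (-‿cong (ι≈× (suc m))) (ι≈× n))))
  ⟦⟧-+ -[1+ m ] -[1+ n ] = begin
    - ι (suc (suc (m ℕ.+ n)))           ≡⟨ ≡.cong (λ k → - ι (suc k)) (ℕ.+-suc m n) ⟨
    - ι (suc m ℕ.+ suc n)               ≈⟨ -‿cong (ι≈× (suc m ℕ.+ suc n)) ⟩
    - ((suc m ℕ.+ suc n) ×ℕ 1#)          ≈⟨ -‿cong (×-homo-+ 1# (suc m) (suc n)) ⟩
    - (suc m ×ℕ 1# + suc n ×ℕ 1#)         ≈⟨ ⁻¹-∙-comm _ _ ⟨
    - (suc m ×ℕ 1#) + - (suc n ×ℕ 1#)     ≈⟨ +-cong (-‿cong (ι≈× (suc m))) (-‿cong (ι≈× (suc n))) ⟨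
    - ι (suc m) + - ι (suc n)           ∎

  ι-* : ∀ m n → ι (m ℕ.* n) ≈ ι m * ι n
  ι-* m n = trans (ι≈× (m ℕ.* n)) (trans (×1-homo-* m n) (sym (*-cong (ι≈× m) (ι≈× n))))

  ⟦⟧-pos◃ : ∀ n → ⟦ Sign.+ ℤ.◃ n ⟧ ≈ ι n
  ⟦⟧-pos◃ zero    = refl
  ⟦⟧-pos◃ (suc n) = refl

  ⟦⟧-neg◃ : ∀ n → ⟦ Sign.- ℤ.◃ n ⟧ ≈ - ι n
  ⟦⟧-neg◃ zero    = sym ε⁻¹≈ε
  ⟦⟧-neg◃ (suc n) = refl

  ⟦⟧-* : ∀ i j → ⟦ i ℤ.* j ⟧ ≈ ⟦ i ⟧ * ⟦ j ⟧
  ⟦⟧-* (ℤ.+ m) (ℤ.+ n) = trans (⟦⟧-pos◃ (m ℕ.* n)) (ι-* m n)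
  ⟦⟧-* (ℤ.+ m) -[1+ n ] = trans (⟦⟧-neg◃ (m ℕ.* suc n))
    (trans (-‿cong (ι-* m (suc n))) (-‿distribʳ-* _ _))
  ⟦⟧-* -[1+ m ] (ℤ.+ n) = trans (⟦⟧-neg◃ (suc m ℕ.* n))
    (trans (-‿cong (ι-* (suc m) n)) (-‿distribˡ-* _ _))
  ⟦⟧-* -[1+ m ] -[1+ n ] = begin
    ι (suc m ℕ.* suc n)               ≈⟨ ι-* (suc m) (suc n) ⟩
    ι (suc m) * ι (suc n)             ≈⟨ ⁻¹-involutive _ ⟨
    - - (ι (suc m) * ι (suc n))       ≈⟨ -‿cong (-‿distribʳ-* _ _) ⟩
    - (ι (suc m) * - ι (suc n))       ≈⟨ -‿distribˡ-* _ _ ⟩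
    - ι (suc m) * - ι (suc n)         ∎

  -- The solver normalises by computing with its coefficients. The carrier is abstract and nothing
  -- in it reduces, so numerals are kept as integers.
  morphism : ℤ.+-*-rawRing -Raw-AlmostCommutative⟶ fromCommutativeRing R
  morphism = record
    { ⟦_⟧    = ⟦_⟧
    ; +-homo = ⟦⟧-+
    ; *-homo = ⟦⟧-*
    ; -‿homo = ⟦⟧-neg
    ; 0-homo = refl
    ; 1-homo = refl
    }

  coefficient≟ : WeaklyDecidable (λ i j → ⟦ i ⟧ ≈ ⟦ j ⟧)
  coefficient≟ i j with i ℤ.≟ j
  ... | yes i≡j = just (reflexive (≡.cong ⟦_⟧ i≡j))
  ... | no  _   = nothing

  open RingSolver ℤ.+-*-rawRing (fromCommutativeRing R) morphism coefficient≟ public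
    using (solve; con; _:=_; _:+_; _:*_; _:-_; :-_; Polynomial)

  # : ∀ {n} → ℕ → Polynomial n
  # k = con (ℤ.+ k)

module Regularity (em : ExcludedMiddle 0ℓ) (reals : CompleteOrderedField) where
  open Analysis em reals
  open CommutativeRing commutativeRing
    using ( +-cong; +-congˡ; +-congʳ; *-cong; *-congˡ; *-congʳ; -‿cong; +-assoc; +-comm; *-assoc; *-comm
          ; +-identityˡ; +-identityʳ; *-identityˡ; *-identityʳ; zeroˡ; zeroʳ; distribˡ; distribʳ
          ; -‿inverseʳ; setoid; refl; sym; trans; reflexive)
  open SemiringMult (CommutativeRing.semiring commutativeRing) using (×1-homo-*)
  open SemiringExp (CommutativeRing.semiring commutativeRing) using (^-congˡ; ^-assocʳ)
  open CommutativeSemiringExp (CommutativeRing.commutativeSemiring commutativeRing) using (^-distrib-*)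
  open IntegerCoefficientSolver commutativeRing
    using (solve; _:=_; _:+_; _:*_; _:-_; :-_; #)
  open SetoidReasoning setoid
  open IsTotalOrder isTotalOrder
    using (antisym; total; ≤-respˡ-≈; ≤-respʳ-≈)
    renaming (refl to ≤-refl; trans to ≤-trans; reflexive to ≤-reflexive)

  -- Arithmetic of the ordered field

  ≤-resp : ∀ {x x′ y y′} → x ≈ x′ → y ≈ y′ → x ≤ y → x′ ≤ y′
  ≤-resp p q = ≤-respˡ-≈ p ∘ ≤-respʳ-≈ q

  0≤y-x : ∀ {x y} → x ≤ y → 0# ≤ y - x
  0≤y-x {x} {y} p = ≤-respˡ-≈ (-‿inverseʳ x) (+-monoˡ-≤ (- x) p)

  ≤-by : ∀ {x y e} → 0# ≤ e → x + e ≈ y → x ≤ y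
  ≤-by {x} {y} {e} p q = ≤-resp (+-identityˡ x) (trans (+-comm e x) q) (+-monoˡ-≤ x p)

  +-mono-≤ : ∀ {x x′ y y′} → x ≤ x′ → y ≤ y′ → x + y ≤ x′ + y′
  +-mono-≤ {x} {x′} {y} {y′} p q =
    ≤-trans (+-monoˡ-≤ y p) (≤-resp (+-comm y x′) (+-comm y′ x′) (+-monoˡ-≤ x′ q))

  +-nonNeg : ∀ {x y} → 0# ≤ x → 0# ≤ y → 0# ≤ x + y
  +-nonNeg p q = ≤-respˡ-≈ (+-identityˡ 0#) (+-mono-≤ p q)

  *-monoʳ-≤ : ∀ {x y} z → 0# ≤ z → x ≤ y → z * x ≤ z * y
  *-monoʳ-≤ {x} {y} z p q =
    ≤-by (*-nonNeg p (0≤y-x q)) (solve 3 (λ x y z → z :* x :+ z :* (y :- x) := z :* y) refl x y z)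

  *-mono-≤ : ∀ {x x′ y y′} → 0# ≤ x → 0# ≤ y′ → x ≤ x′ → y ≤ y′ → x * y ≤ x′ * y′
  *-mono-≤ {x} {x′} {y} {y′} p q r s =
    ≤-trans (*-monoʳ-≤ x p s) (≤-resp (*-comm y′ x) (*-comm y′ x′) (*-monoʳ-≤ y′ q r))

  0≤x² : ∀ x → 0# ≤ x * x
  0≤x² x with total 0# x
  ... | inj₁ 0≤x = *-nonNeg 0≤x 0≤x
  ... | inj₂ x≤0 = ≤-respʳ-≈ (solve 1 (λ x → (# 0 :- x) :* (# 0 :- x) := x :* x) refl x)
                     (*-nonNeg (0≤y-x x≤0) (0≤y-x x≤0))

  0≤1 : 0# ≤ 1#
  0≤1 = ≤-respʳ-≈ (*-identityˡ 1#) (0≤x² 1#)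

  0<1 : 0# < 1#
  0<1 = 0≤1 , 0≉1

  <⇒≤ : ∀ {x y} → x < y → x ≤ y
  <⇒≤ = proj₁

  <⇒≱ : ∀ {x y} → x < y → ¬ (y ≤ x)
  <⇒≱ = Strict.<⇒≱ _≈_ _≤_ antisym

  <-≤-trans : ∀ {x y z} → x < y → y ≤ z → x < z
  <-≤-trans = Strict.<-≤-trans _≈_ _≤_ sym ≤-trans antisym ≤-respʳ-≈

  ≤-<-trans : ∀ {x y z} → x ≤ y → y < z → x < z
  ≤-<-trans = Strict.≤-<-trans _≈_ _≤_ ≤-trans antisym ≤-respˡ-≈

  <-resp : ∀ {x x′ y y′} → x ≈ x′ → y ≈ y′ → x < y → x′ < y′
  <-resp p q (r , s) = ≤-resp p q r , λ t → s (trans p (trans t (sym q)))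

  ≤⊎> : ∀ x y → x ≤ y ⊎ y < x
  ≤⊎> x y with em {x ≤ y}
  ... | yes p = inj₁ p
  ... | no ¬p with total x y
  ...   | inj₁ p = inj₁ p
  ...   | inj₂ q = inj₂ (q , λ e → ¬p (≤-reflexive (sym e)))

  ≮⇒≥ : ∀ {x y} → ¬ (x < y) → y ≤ x
  ≮⇒≥ {x} {y} p with ≤⊎> y x
  ... | inj₁ q = q
  ... | inj₂ q = ⊥-elim (p q)

  >0⇒≉0 : ∀ {x} → 0# < x → ¬ (x ≈ 0#)
  >0⇒≉0 (_ , p) q = p (sym q)

  <⇒0<y-x : ∀ {x y} → x < y → 0# < y - x
  <⇒0<y-x {x} {y} (p , q) = 0≤y-x p , λ e → q (begin
    x              ≈⟨ +-identityʳ x ⟨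
    x + 0#         ≈⟨ +-congˡ e ⟩
    x + (y - x)    ≈⟨ solve 2 (λ x y → x :+ (y :- x) := y) refl x y ⟩
    y              ∎)

  <-by : ∀ {x y e} → 0# < e → x + e ≈ y → x < y
  <-by {x} {y} {e} (p , q) r = ≤-by p r , λ s → q (begin
    0#             ≈⟨ -‿inverseʳ x ⟨
    x - x          ≈⟨ +-congʳ (trans s (sym r)) ⟩
    x + e - x      ≈⟨ solve 2 (λ x e → x :+ e :- x := e) refl x e ⟩
    e              ∎)

  integral : ∀ {x y} → ¬ (x ≈ 0#) → x * y ≈ 0# → y ≈ 0#
  integral {x} {y} p q with inverse x p
  ... | x′ , e = begin
    y                ≈⟨ *-identityˡ y ⟨
    1# * y           ≈⟨ *-congʳ e ⟨
    x * x′ * y       ≈⟨ solve 3 (λ x y z → x :* z :* y := z :* (x :* y)) refl x y x′ ⟩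
    x′ * (x * y)     ≈⟨ *-congˡ q ⟩
    x′ * 0#          ≈⟨ zeroʳ x′ ⟩
    0#               ∎

  *-pos : ∀ {x y} → 0# < x → 0# < y → 0# < x * y
  *-pos p q = *-nonNeg (proj₁ p) (proj₁ q) , λ e → >0⇒≉0 q (integral (>0⇒≉0 p) (sym e))

  +-pos : ∀ {x y} → 0# < x → 0# ≤ y → 0# < x + y
  +-pos {x} {y} p q = <-≤-trans p (≤-by q refl)

  *-cancelˡ-≤ : ∀ {x y} z → 0# < z → z * x ≤ z * y → x ≤ y
  *-cancelˡ-≤ {x} {y} z p q = ≮⇒≥ λ y<x → <⇒≱ (*-pos p (<⇒0<y-x y<x))
    (≤-by (0≤y-x q) (solve 3 (λ x y z → z :* (x :- y) :+ (z :* y :- z :* x) := # 0) refl x y z))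

  *-cancelˡ-≈ : ∀ {x y} z → 0# < z → z * x ≈ z * y → x ≈ y
  *-cancelˡ-≈ z p q = antisym (*-cancelˡ-≤ z p (≤-reflexive q)) (*-cancelˡ-≤ z p (≤-reflexive (sym q)))

  0≤fromℕ : ∀ n → 0# ≤ fromℕ n
  0≤fromℕ zero    = ≤-refl
  0≤fromℕ (suc n) = +-nonNeg 0≤1 (0≤fromℕ n)

  0<fromℕ-suc : ∀ n → 0# < fromℕ (suc n)
  0<fromℕ-suc n = +-pos 0<1 (0≤fromℕ n)

  0<fromℕ : ∀ n .{{_ : ℕ.NonZero n}} → 0# < fromℕ n
  0<fromℕ (suc n) = 0<fromℕ-suc n

  fromℕ-mono-≤ : ∀ {m n} → m ℕ.≤ n → fromℕ m ≤ fromℕ n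
  fromℕ-mono-≤ {n = n} ℕ.z≤n = 0≤fromℕ n
  fromℕ-mono-≤ (ℕ.s≤s p)     = +-mono-≤ ≤-refl (fromℕ-mono-≤ p)

  the-satisfies : ∀ (P : Pred ℝ 0ℓ) → ∃ P → P (the P)
  the-satisfies P w with em {∃ P}
  ... | yes v = proj₂ v
  ... | no ¬w = ⊥-elim (¬w w)

  *-inverseʳ : ∀ {x} → ¬ (x ≈ 0#) → x * x ⁻¹ ≈ 1#
  *-inverseʳ {x} p = the-satisfies (λ y → x * y ≈ 1#) (inverse x p)

  ⁻¹-pos : ∀ {x} → 0# < x → 0# < x ⁻¹
  ⁻¹-pos {x} p with ≤⊎> (x ⁻¹) 0#
  ... | inj₂ q = q
  ... | inj₁ q = ⊥-elim (<⇒≱ 0<1 (≤-resp (*-inverseʳ (>0⇒≉0 p)) (zeroʳ x) (*-monoʳ-≤ x (proj₁ p) q)))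

  ⊔-lub : ∀ {x y z} → x ≤ z → y ≤ z → x ⊔ y ≤ z
  ⊔-lub {x} {y} p q with total y x
  ... | inj₁ _ = p
  ... | inj₂ _ = q

  x≤x⊔y : ∀ x y → x ≤ x ⊔ y
  x≤x⊔y x y with total y x
  ... | inj₁ _ = ≤-refl
  ... | inj₂ p = p

  y≤x⊔y : ∀ x y → y ≤ x ⊔ y
  y≤x⊔y x y with total y x
  ... | inj₁ p = p
  ... | inj₂ _ = ≤-refl

  ∣x∣≤r : ∀ {x r} → x ≤ r → - x ≤ r → ∣ x ∣ ≤ r
  ∣x∣≤r = ⊔-lub

  x≤∣x∣ : ∀ x → x ≤ ∣ x ∣
  x≤∣x∣ x = x≤x⊔y x (- x)

  -x≤∣x∣ : ∀ x → - x ≤ ∣ x ∣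
  -x≤∣x∣ x = y≤x⊔y x (- x)

  0≤x⇒∣x∣≈x : ∀ {x} → 0# ≤ x → ∣ x ∣ ≈ x
  0≤x⇒∣x∣≈x {x} p = antisym (∣x∣≤r ≤-refl (≤-by (+-nonNeg p p)
    (solve 1 (λ x → :- x :+ (x :+ x) := x) refl x))) (x≤∣x∣ x)

  -- Suprema, the Archimedean property and powers

  sup-isLeastUpperBound : ∀ S → Satisfiable S → ∃ (IsUpperBound S) → IsLeastUpperBound S (sup S)
  sup-isLeastUpperBound S s b = the-satisfies (IsLeastUpperBound S) (complete S s b)

  approach-lub : ∀ {S s ρ} → IsLeastUpperBound S s → 0# < ρ → ∃[ x ] x ∈ S × s - ρ < x
  approach-lub {S} {s} {ρ} (_ , least) 0<ρ with em {∃[ x ] x ∈ S × s - ρ < x}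
  ... | yes p = p
  ... | no ¬p = ⊥-elim (<⇒≱ (<-by 0<ρ (solve 2 (λ s ρ → s :- ρ :+ ρ := s) refl s ρ))
                  (least (s - ρ) λ x x∈S → ≮⇒≥ λ q → ¬p (x , x∈S , q)))

  -- Otherwise the naturals have a least upper bound `s`, and the successor of a natural above
  -- `s - 1` exceeds it.
  archimedean : ∀ x → ∃[ n ] x ≤ fromℕ n
  archimedean x with em {∃[ n ] x ≤ fromℕ n}
  ... | yes p = p
  ... | no ¬p = ⊥-elim (contradiction (complete S (0# , 0 , refl) (x , bounded)))
    where
    S : Pred ℝ 0ℓ
    S y = ∃[ n ] y ≈ fromℕ n
    bounded : IsUpperBound S x
    bounded y (n , e) = ≤-respˡ-≈ (sym e) (≮⇒≥ λ q → ¬p (n , proj₁ q))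
    contradiction : ¬ ∃ (IsLeastUpperBound S)
    contradiction (s , lub) with approach-lub lub 0<1
    ... | y , (n , e) , q = <⇒≱ q (≤-resp (sym e)
      refl (≤-by (0≤y-x (proj₁ lub (fromℕ (suc n)) (suc n , refl)))
        (solve 2 (λ s k → k :+ (s :- (# 1 :+ k)) := s :- # 1) refl s (fromℕ n))))

  ceiling : ∀ x → 0# ≤ x → ∃[ n ] x ≤ fromℕ n × fromℕ n ≤ x + 1#
  ceiling x 0≤x with archimedean x
  ... | N , p = descend N p
    where
    descend : ∀ N → x ≤ fromℕ N → ∃[ n ] x ≤ fromℕ n × fromℕ n ≤ x + 1#
    descend zero    p = zero , p , +-nonNeg 0≤x 0≤1
    descend (suc N) p with ≤⊎> x (fromℕ N)
    ... | inj₁ q = descend N q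
    ... | inj₂ q = suc N , p , ≤-respˡ-≈ (+-comm (fromℕ N) 1#) (+-monoˡ-≤ 1# (proj₁ q))

  ^-nonNeg : ∀ {x} n → 0# ≤ x → 0# ≤ x ^ n
  ^-nonNeg zero    p = 0≤1
  ^-nonNeg (suc n) p = *-nonNeg p (^-nonNeg n p)

  ^-pos : ∀ {x} n → 0# < x → 0# < x ^ n
  ^-pos zero    p = 0<1
  ^-pos (suc n) p = *-pos p (^-pos n p)

  ^-monoˡ-≤ : ∀ {x y} n → 0# ≤ x → x ≤ y → x ^ n ≤ y ^ n
  ^-monoˡ-≤ zero    p q = ≤-refl
  ^-monoˡ-≤ (suc n) p q = *-mono-≤ p (^-nonNeg n (≤-trans p q)) q (^-monoˡ-≤ n p q)

  1^n≈1 : ∀ n → 1# ^ n ≈ 1#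
  1^n≈1 zero    = refl
  1^n≈1 (suc n) = trans (*-identityˡ _) (1^n≈1 n)

  1≤x^n : ∀ {x} n → 1# ≤ x → 1# ≤ x ^ n
  1≤x^n n p = ≤-respˡ-≈ (1^n≈1 n) (^-monoˡ-≤ n 0≤1 p)

  -- The tangent of `x ^ suc k` at `a`, in a form free of division. In the induction the defect is
  -- multiplied by `b` and grows by `(k + 1) (b - a)² a ^ k`. It serves twice: termwise in the
  -- exponential series, and for `H` as a power of `Q`.
  bernoulli : ∀ {a b} k → 0# ≤ a → 0# ≤ b →
              a ^ suc k + fromℕ (suc k) * (b - a) * a ^ k ≤ b ^ suc k
  bernoulli {a} {b} zero p q = ≤-reflexive
    (solve 2 (λ a b → a :* # 1 :+ (# 1 :+ # 0) :* (b :- a) :* # 1 := b :* # 1) refl a b)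
  bernoulli {a} {b} (suc k) p q = ≤-by
    (+-nonNeg (*-nonNeg q (0≤y-x (bernoulli k p q)))
              (*-nonNeg (*-nonNeg (0≤fromℕ (suc k)) (0≤x² (b - a))) (^-nonNeg k p)))
    (solve 5 (λ a b A B K →
        a :* (a :* A) :+ (# 1 :+ K) :* (b :- a) :* (a :* A)
        :+ (b :* (B :- (a :* A :+ K :* (b :- a) :* A)) :+ K :* ((b :- a) :* (b :- a)) :* A)
        := b :* B)
      refl a b (a ^ k) (b ^ suc k) (fromℕ (suc k)))


  -- Limits and series

  infix 4 _within_
  -- Stands in for `∣ x ∣ ≤ r`. A pair of inequalities can be added and handed to the ring solver
  -- without the case split hidden in `_⊔_`.
  _within_ : ℝ → ℝ → Set
  x within r = x ≤ r × - x ≤ r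

  within-resp : ∀ {x x′ r r′} → x ≈ x′ → r ≈ r′ → x within r → x′ within r′
  within-resp p q (r , s) = ≤-resp p q r , ≤-resp (-‿cong p) q s

  within-self : ∀ {x} → 0# ≤ x → x within x
  within-self {x} p = ≤-refl , ≤-by (+-nonNeg p p) (solve 1 (λ x → :- x :+ (x :+ x) := x) refl x)

  within-+ : ∀ {x y r s} → x within r → y within s → x + y within r + s
  within-+ {x} {y} (p , p′) (q , q′) =
    +-mono-≤ p q , ≤-respˡ-≈ (solve 2 (λ x y → :- x :+ :- y := :- (x :+ y)) refl x y) (+-mono-≤ p′ q′)

  within-* : ∀ {x y r s} → 0# ≤ r → x within r → y within s → x * y within r * s
  within-* {x} {y} {r} {s} 0≤r (p , p′) (q , q′) with total 0# y
  ... | inj₁ 0≤y = ≤-trans (≤-resp (*-comm y x) (*-comm y r) (*-monoʳ-≤ y 0≤y p)) (*-monoʳ-≤ r 0≤r q)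
                 , ≤-trans (≤-resp (solve 2 (λ x y → y :* :- x := :- (x :* y)) refl x y) (*-comm y r) (*-monoʳ-≤ y 0≤y p′))
                     (*-monoʳ-≤ r 0≤r q)
  ... | inj₂ y≤0 = ≤-trans (≤-by (*-nonNeg (0≤y-x y≤0) (0≤y-x p′))
                       (solve 3 (λ x y r → x :* y :+ (# 0 :- y) :* (r :- :- x) := r :* :- y) refl x y r))
                     (*-monoʳ-≤ r 0≤r q′)
                 , ≤-trans (≤-by (*-nonNeg (0≤y-x y≤0) (0≤y-x p))
                       (solve 3 (λ x y r → :- (x :* y) :+ (# 0 :- y) :* (r :- x) := r :* :- y) refl x y r))
                     (*-monoʳ-≤ r 0≤r q′)

  ½ : ℝ
  ½ = fromℕ 2 ⁻¹

  0<½ : 0# < ½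
  0<½ = ⁻¹-pos (0<fromℕ 2)

  ½+½ : ∀ x → ½ * x + ½ * x ≈ x
  ½+½ x = begin
    ½ * x + ½ * x         ≈⟨ solve 2 (λ h x → h :* x :+ h :* x := # 2 :* h :* x) refl ½ x ⟩
    fromℕ 2 * ½ * x       ≈⟨ *-congʳ (*-inverseʳ (>0⇒≉0 (0<fromℕ 2))) ⟩
    1# * x                ≈⟨ *-identityˡ x ⟩
    x                     ∎

  limit-mono-≤ : ∀ {a b L M} → (∀ n → a n ≤ b n) → IsLimit a L → IsLimit b M → L ≤ M
  limit-mono-≤ {a} {b} {L} {M} a≤b lim lim′ = ≮⇒≥ λ M<L →
    let ε   = ½ * (L - M)
        0<ε = *-pos 0<½ (<⇒0<y-x M<L)
        (N , close)   = lim ε 0<ε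
        (N′ , close′) = lim′ ε 0<ε
        n  = N ℕ.⊔ N′
        L-a<ε = ≤-<-trans (-x≤∣x∣ (a n - L)) (close n (ℕ.m≤m⊔n N N′))
        b-M<ε = ≤-<-trans (x≤∣x∣ (b n - M)) (close′ n (ℕ.m≤n⊔m N N′))
    in <⇒≱ (+-pos (<⇒0<y-x L-a<ε) (+-nonNeg (0≤y-x (proj₁ b-M<ε)) (0≤y-x (a≤b n))))
         (≤-reflexive (begin
           ε - - (a n - L) + (ε - (b n - M) + (b n - a n))
             ≈⟨ solve 5 (λ e a b L M → e :- :- (a :- L) :+ (e :- (b :- M) :+ (b :- a)) := e :+ e :- (L :- M))
                  refl ε (a n) (b n) L M ⟩
           ε + ε - (L - M)            ≈⟨ +-congʳ (½+½ (L - M)) ⟩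
           L - M - (L - M)            ≈⟨ -‿inverseʳ (L - M) ⟩
           0#                         ∎))

  limit-resp : ∀ {a b L} → (∀ n → a n ≈ b n) → IsLimit a L → IsLimit b L
  limit-resp a≈b lim ε 0<ε with lim ε 0<ε
  ... | N , close = N , λ n N≤n → ≤-<-trans
    (∣x∣≤r (≤-respˡ-≈ (+-congʳ (a≈b n)) (x≤∣x∣ _)) (≤-respˡ-≈ (-‿cong (+-congʳ (a≈b n))) (-x≤∣x∣ _)))
    (close n N≤n)

  limit-cong : ∀ {a b L M} → (∀ n → a n ≈ b n) → IsLimit a L → IsLimit b M → L ≈ M
  limit-cong a≈b lim lim′ = antisym (limit-mono-≤ (≤-reflexive ∘ a≈b) lim lim′)
                                    (limit-mono-≤ (≤-reflexive ∘ sym ∘ a≈b) lim′ lim)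

  Range : (ℕ → ℝ) → Pred ℝ 0ℓ
  Range a y = ∃[ n ] y ≈ a n

  monotone : ∀ (a : ℕ → ℝ) → (∀ n → a n ≤ a (suc n)) → ∀ {m n} → m ℕ.≤ n → a m ≤ a n
  monotone a step p = go (ℕ.≤⇒≤′ p)
    where
    go : ∀ {m n} → m ℕ.≤′ n → a m ≤ a n
    go (ℕ.≤′-reflexive ≡.refl) = ≤-refl
    go (ℕ.≤′-step q)             = ≤-trans (go q) (step _)

  approach-sup : ∀ {a s} → (∀ n → a n ≤ a (suc n)) → IsLeastUpperBound (Range a) s →
                 ∀ ε → 0# < ε → ∃[ N ] (∀ n → N ℕ.≤ n → s - a n < ε)
  approach-sup {a} {s} step lub ε 0<ε with approach-lub lub 0<ε
  ... | x , (N , x≈aN) , s-ε<x = N , λ n N≤n →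
    <-by (<⇒0<y-x (<-≤-trans s-ε<x (≤-respˡ-≈ (sym x≈aN) (monotone a step N≤n))))
      (solve 3 (λ s a e → s :- a :+ (a :- (s :- e)) := e) refl s (a n) ε)

  monotone-limit : ∀ {a s} → (∀ n → a n ≤ a (suc n)) → IsLeastUpperBound (Range a) s → IsLimit a s
  monotone-limit {a} {s} step lub ε 0<ε with approach-sup step lub ε 0<ε
  ... | N , close = N , λ n N≤n → ≤-<-trans
    (∣x∣≤r (≤-by (+-nonNeg (0≤s-a n) (0≤s-a n)) (solve 2 (λ s a → a :- s :+ (s :- a :+ (s :- a)) := s :- a) refl s (a n)))
           (≤-reflexive (solve 2 (λ s a → :- (a :- s) := s :- a) refl s (a n))))
    (close n N≤n)
    where
    0≤s-a : ∀ n → 0# ≤ s - a n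
    0≤s-a n = 0≤y-x (proj₁ lub (a n) (n , refl))

  -- Partial sums and Cauchy products

  partialSum : (ℕ → ℝ) → ℕ → ℝ
  partialSum a zero    = 0#
  partialSum a (suc n) = partialSum a n + a n

  partialSum-head : ∀ a n → partialSum a (suc n) ≈ a 0 + partialSum (a ∘ suc) n
  partialSum-head a zero    = +-comm 0# (a 0)
  partialSum-head a (suc n) = trans (+-congʳ (partialSum-head a n)) (+-assoc _ _ _)

  sum≈partialSum : ∀ a n → sum {n} (a ∘ toℕ) ≈ partialSum a n
  sum≈partialSum a zero    = refl
  sum≈partialSum a (suc n) = trans (+-congˡ (sum≈partialSum (a ∘ suc) n)) (sym (partialSum-head a n))

  partialSum-cong : ∀ {a b} → (∀ k → a k ≈ b k) → ∀ n → partialSum a n ≈ partialSum b n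
  partialSum-cong p zero    = refl
  partialSum-cong p (suc n) = +-cong (partialSum-cong p n) (p n)

  partialSum-nonNeg : ∀ {a} → (∀ k → 0# ≤ a k) → ∀ n → 0# ≤ partialSum a n
  partialSum-nonNeg p zero    = ≤-refl
  partialSum-nonNeg p (suc n) = +-nonNeg (partialSum-nonNeg p n) (p n)

  partialSum-step : ∀ {a} → (∀ k → 0# ≤ a k) → ∀ n → partialSum a n ≤ partialSum a (suc n)
  partialSum-step p n = ≤-by (p n) refl

  partialSum-within : ∀ {b β} → (∀ k → b k within β k) → ∀ n → partialSum b n within partialSum β n
  partialSum-within p zero    = within-self ≤-refl
  partialSum-within p (suc n) = within-+ (partialSum-within p n) (p n)

  partialSum-tail-within : ∀ {b β} → (∀ k → b k within β k) → ∀ {m n} → m ℕ.≤ n →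
    partialSum b n - partialSum b m within partialSum β n - partialSum β m
  partialSum-tail-within {b} {β} p q = go (ℕ.≤⇒≤′ q)
    where
    go : ∀ {m n} → m ℕ.≤′ n → partialSum b n - partialSum b m within partialSum β n - partialSum β m
    go {m} (ℕ.≤′-reflexive ≡.refl) = within-resp (sym (-‿inverseʳ _)) (sym (-‿inverseʳ _))
      (within-self ≤-refl)
    go {m} (ℕ.≤′-step {n} q) = within-resp (rearrange b) (rearrange β) (within-+ (go q) (p n))
      where
      rearrange : ∀ c → partialSum c n - partialSum c m + c n ≈ partialSum c n + c n - partialSum c m
      rearrange c = solve 3 (λ x y z → x :- y :+ z := x :+ z :- y) refl (partialSum c n) (partialSum c m) (c n)

  -- The convolution ∑_{i+j=n} a i * b j and the triangular sum ∑_{i+j<n} a i * b j.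
  conv : (ℕ → ℝ) → (ℕ → ℝ) → ℕ → ℝ
  conv a b zero    = a 0 * b 0
  conv a b (suc n) = a 0 * b (suc n) + conv (a ∘ suc) b n

  triangle : (ℕ → ℝ) → (ℕ → ℝ) → ℕ → ℝ
  triangle a b zero    = 0#
  triangle a b (suc n) = a 0 * partialSum b (suc n) + triangle (a ∘ suc) b n

  triangle-suc : ∀ a b n → triangle a b (suc n) ≈ triangle a b n + conv a b n
  triangle-suc a b zero = solve 2 (λ x y → x :* (# 0 :+ y) :+ # 0 := # 0 :+ x :* y) refl (a 0) (b 0)
  triangle-suc a b (suc n) = begin
    a 0 * (partialSum b (suc n) + b (suc n)) + triangle (a ∘ suc) b (suc n)
      ≈⟨ +-congˡ (triangle-suc (a ∘ suc) b n) ⟩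
    a 0 * (partialSum b (suc n) + b (suc n)) + (triangle (a ∘ suc) b n + conv (a ∘ suc) b n)
      ≈⟨ solve 5 (λ x s y t c → x :* (s :+ y) :+ (t :+ c) := x :* s :+ t :+ (x :* y :+ c)) refl
           (a 0) (partialSum b (suc n)) (b (suc n)) (triangle (a ∘ suc) b n) (conv (a ∘ suc) b n) ⟩
    triangle a b (suc n) + conv a b (suc n) ∎

  triangle≈partialSum-conv : ∀ a b n → triangle a b n ≈ partialSum (conv a b) n
  triangle≈partialSum-conv a b zero    = refl
  triangle≈partialSum-conv a b (suc n) = trans (triangle-suc a b n) (+-congʳ (triangle≈partialSum-conv a b n))

  -- The difference is the sum of `a i * b j` over the pairs with `i < n`, `j < m` and `n ≤ i + j`,
  -- and each of these terms is dominated by `α i * β j`. The separate bound `m` serves the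
  -- induction: removing the row `i = 0` lowers `n` but not `m`.
  square-triangle-within : ∀ {a b α β} → (∀ k → 0# ≤ α k) → (∀ k → a k within α k) → (∀ k → b k within β k) →
    ∀ {n m} → n ℕ.≤ m →
    partialSum a n * partialSum b m - triangle a b n within partialSum α n * partialSum β m - triangle α β n
  square-triangle-within {b = b} {β = β} 0≤α p q {zero} {m} _ = within-resp (zero-case (partialSum b m)) (zero-case (partialSum β m))
    (within-self ≤-refl)
    where
    zero-case : ∀ x → 0# ≈ 0# * x - 0#
    zero-case = solve 1 (λ x → # 0 := # 0 :* x :- # 0) refl
  square-triangle-within {a} {b} {α} {β} 0≤α p q {suc n} {m} n<m =
    within-resp (peel a b) (peel α β)
      (within-+ (within-* (0≤α 0) (p 0) (partialSum-tail-within q n<m))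
                (square-triangle-within (0≤α ∘ suc) (p ∘ suc) q (ℕ.<⇒≤ n<m)))
    where
    peel : ∀ c d → c 0 * (partialSum d m - partialSum d (suc n)) +
                   (partialSum (c ∘ suc) n * partialSum d m - triangle (c ∘ suc) d n)
                 ≈ partialSum c (suc n) * partialSum d m - triangle c d (suc n)
    peel c d = trans
      (solve 5 (λ x y z s t → x :* (y :- z) :+ (s :* y :- t) := (x :+ s) :* y :- (x :* z :+ t)) refl
        (c 0) (partialSum d m) (partialSum d (suc n)) (partialSum (c ∘ suc) n) (triangle (c ∘ suc) d n))
      (+-congʳ (*-congʳ (sym (partialSum-head c n))))

  -- Pairs with `i < n` and `j < m` satisfy `i + j < n + m`, and the other terms of the triangle are
  -- non-negative.
  square≤triangle : ∀ {α β} → (∀ k → 0# ≤ α k) → (∀ k → 0# ≤ β k) → ∀ n m →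
    partialSum α n * partialSum β m ≤ triangle α β (n ℕ.+ m)
  square≤triangle {α} {β} p q zero m = ≤-respˡ-≈ (sym (zeroˡ _))
    (≤-respʳ-≈ (sym (triangle≈partialSum-conv α β m)) (partialSum-nonNeg (conv-nonNeg p) m))
    where
    conv-nonNeg : ∀ {a} → (∀ k → 0# ≤ a k) → ∀ n → 0# ≤ conv a β n
    conv-nonNeg r zero    = *-nonNeg (r 0) (q 0)
    conv-nonNeg r (suc n) = +-nonNeg (*-nonNeg (r 0) (q (suc n))) (conv-nonNeg (r ∘ suc) n)
  square≤triangle {α} {β} p q (suc n) m = ≤-respˡ-≈
    (sym (trans (*-congʳ (partialSum-head α n)) (distribʳ (partialSum β m) (α 0) (partialSum (α ∘ suc) n))))
    (+-mono-≤ (*-monoʳ-≤ (α 0) (p 0) (monotone (partialSum β) (partialSum-step q) (ℕ.m≤n+m m (suc n))))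
              (square≤triangle (p ∘ suc) q n m))

  conv-cong : ∀ {a a′ b b′} → (∀ k → a k ≈ a′ k) → (∀ k → b k ≈ b′ k) → ∀ n → conv a b n ≈ conv a′ b′ n
  conv-cong p q zero    = *-cong (p 0) (q 0)
  conv-cong p q (suc n) = +-cong (*-cong (p 0) (q (suc n))) (conv-cong (p ∘ suc) q n)

  conv-scaleˡ : ∀ s a b n → conv (λ i → s * a i) b n ≈ s * conv a b n
  conv-scaleˡ s a b zero    = *-assoc s (a 0) (b 0)
  conv-scaleˡ s a b (suc n) = trans (+-cong (*-assoc _ _ _) (conv-scaleˡ s (a ∘ suc) b n)) (sym (distribˡ _ _ _))

  conv-scaleʳ : ∀ s a b n → conv a (λ i → s * b i) n ≈ s * conv a b n
  conv-scaleʳ s a b zero    = solve 3 (λ s x y → x :* (s :* y) := s :* (x :* y)) refl s (a 0) (b 0)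
  conv-scaleʳ s a b (suc n) = trans (+-congˡ (conv-scaleʳ s (a ∘ suc) b n))
    (solve 4 (λ s x y c → x :* (s :* y) :+ s :* c := s :* (x :* y :+ c)) refl s (a 0) (b (suc n)) (conv (a ∘ suc) b n))

  conv-last : ∀ a b n → conv a b (suc n) ≈ conv a (b ∘ suc) n + a (suc n) * b 0
  conv-last a b zero    = refl
  conv-last a b (suc n) = trans (+-congˡ (conv-last (a ∘ suc) b n)) (sym (+-assoc _ _ _))

  -- Leibniz rule for the operator `a k ↦ k * a k`, the coefficient form of `x d/dx`: the weights
  -- `i` and `j` add up to `n`. The offset `x` absorbs the shift of indices when `a` is replaced by
  -- `a ∘ suc`.
  conv-weights : ∀ x a b n →
    conv (λ i → (x + fromℕ i) * a i) b n + conv a (λ j → fromℕ j * b j) n ≈ (x + fromℕ n) * conv a b n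
  conv-weights x a b zero =
    solve 3 (λ x a b → (x :+ # 0) :* a :* b :+ a :* (# 0 :* b) := (x :+ # 0) :* (a :* b)) refl x (a 0) (b 0)
  conv-weights x a b (suc n) = begin
    (x + 0#) * a 0 * b (suc n) + conv (λ i → (x + (1# + fromℕ i)) * a (suc i)) b n + (a 0 * ((1# + fromℕ n) * b (suc n)) + c)
      ≈⟨ +-congʳ (+-congˡ (conv-cong (λ i → *-congʳ (sym (+-assoc x 1# (fromℕ i)))) (λ _ → refl) n)) ⟩
    (x + 0#) * a 0 * b (suc n) + c′ + (a 0 * ((1# + fromℕ n) * b (suc n)) + c)
      ≈⟨ solve 6 (λ x n a b c d → (x :+ # 0) :* a :* b :+ d :+ (a :* ((# 1 :+ n) :* b) :+ c)
                                := (x :+ (# 1 :+ n)) :* (a :* b) :+ (d :+ c)) refl x (fromℕ n) (a 0) (b (suc n)) c c′ ⟩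
    (x + (1# + fromℕ n)) * (a 0 * b (suc n)) + (c′ + c)
      ≈⟨ +-congˡ (conv-weights (x + 1#) (a ∘ suc) b n) ⟩
    (x + (1# + fromℕ n)) * (a 0 * b (suc n)) + (x + 1# + fromℕ n) * conv (a ∘ suc) b n
      ≈⟨ solve 4 (λ x n p q → (x :+ (# 1 :+ n)) :* p :+ (x :+ # 1 :+ n) :* q := (x :+ (# 1 :+ n)) :* (p :+ q)) refl
           x (fromℕ n) (a 0 * b (suc n)) (conv (a ∘ suc) b n) ⟩
    (x + (1# + fromℕ n)) * conv a b (suc n) ∎
    where
    c  = conv (a ∘ suc) (λ j → fromℕ j * b j) n
    c′ = conv (λ i → (x + 1# + fromℕ i) * a (suc i)) b n

  -- The exponential series

  expTerm : ℝ → ℕ → ℝ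
  expTerm t k = t ^ k * fromℕ (k !) ⁻¹

  0<fromℕ-! : ∀ k → 0# < fromℕ (k !)
  0<fromℕ-! k = 0<fromℕ (k !) {{ℕ._!≢0 k}}

  factorial-inverse : ∀ k → fromℕ (suc k) * fromℕ (suc k !) ⁻¹ ≈ fromℕ (k !) ⁻¹
  factorial-inverse k = *-cancelˡ-≈ m (0<fromℕ-! k) (begin
    m * (c * i)                 ≈⟨ solve 3 (λ m c i → m :* (c :* i) := c :* m :* i) refl m c i ⟩
    c * m * i                   ≈⟨ *-congʳ (×1-homo-* (suc k) (k !)) ⟨
    fromℕ (suc k !) * i         ≈⟨ *-inverseʳ (>0⇒≉0 (0<fromℕ-! (suc k))) ⟩
    1#                          ≈⟨ *-inverseʳ (>0⇒≉0 (0<fromℕ-! k)) ⟨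
    m * m ⁻¹                    ∎)
    where
    c = fromℕ (suc k)
    m = fromℕ (k !)
    i = fromℕ (suc k !) ⁻¹

  expTerm-suc : ∀ t k → fromℕ (suc k) * expTerm t (suc k) ≈ t * expTerm t k
  expTerm-suc t k = trans
    (solve 4 (λ c t p i → c :* (t :* p :* i) := t :* (p :* (c :* i))) refl (fromℕ (suc k)) t (t ^ k) (fromℕ (suc k !) ⁻¹))
    (*-congˡ (*-congˡ (factorial-inverse k)))

  expTerm-0 : ∀ t → expTerm t 0 ≈ 1#
  expTerm-0 t = begin
    1# * i               ≈⟨ *-congʳ (+-identityʳ 1#) ⟨
    fromℕ 1 * i          ≈⟨ *-inverseʳ (>0⇒≉0 (0<fromℕ 1)) ⟩
    1#                   ∎
    where i = fromℕ (0 !) ⁻¹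

  expTerm-cong : ∀ {s t} → s ≈ t → ∀ k → expTerm s k ≈ expTerm t k
  expTerm-cong p k = *-congʳ (^-congˡ k p)

  expTerm-nonNeg : ∀ {t} → 0# ≤ t → ∀ k → 0# ≤ expTerm t k
  expTerm-nonNeg p k = *-nonNeg (^-nonNeg k p) (<⇒≤ (⁻¹-pos (0<fromℕ-! k)))

  expTerm-neg-within : ∀ {t} → 0# ≤ t → ∀ k → expTerm (- t) k within expTerm t k
  expTerm-neg-within {t} p k = within-* (^-nonNeg k p) (power k)
    (within-self q)
    where
    q = <⇒≤ (⁻¹-pos (0<fromℕ-! k))
    power : ∀ k → (- t) ^ k within t ^ k
    power zero    = within-self 0≤1
    power (suc k) = within-* p (≤-by (+-nonNeg p p) (solve 1 (λ x → :- x :+ (x :+ x) := x) refl t)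
                               , ≤-reflexive (solve 1 (λ x → :- :- x := x) refl t)) (power k)

  -- The binomial theorem without binomial coefficients: by `conv-weights`, the convolution `c`
  -- obeys `(n + 1) c (n + 1) = (s + t) c n`, which is the recursion of `expTerm (s + t)`.
  conv-expTerm : ∀ s t n → conv (expTerm s) (expTerm t) n ≈ expTerm (s + t) n
  conv-expTerm s t zero = begin
    expTerm s 0 * expTerm t 0   ≈⟨ *-cong (expTerm-0 s) (expTerm-0 t) ⟩
    1# * 1#                     ≈⟨ *-identityˡ 1# ⟩
    1#                          ≈⟨ expTerm-0 (s + t) ⟨
    expTerm (s + t) 0           ∎
  conv-expTerm s t (suc n) = *-cancelˡ-≈ (fromℕ (suc n)) (0<fromℕ-suc n) (begin
    fromℕ (suc n) * conv a b (suc n)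
      ≈⟨ *-congʳ (+-identityˡ _) ⟨
    (0# + fromℕ (suc n)) * conv a b (suc n)
      ≈⟨ conv-weights 0# a b (suc n) ⟨
    conv (λ i → (0# + fromℕ i) * a i) b (suc n) + conv a (λ j → fromℕ j * b j) (suc n)
      ≈⟨ +-cong (conv-cong (λ i → *-congʳ {a i} (+-identityˡ (fromℕ i))) (λ _ → refl) (suc n)) (conv-last a (λ j → fromℕ j * b j) n) ⟩
    0# * a 0 * b (suc n) + conv (λ i → fromℕ (suc i) * a (suc i)) b n +
      (conv a (λ j → fromℕ (suc j) * b (suc j)) n + a (suc n) * (0# * b 0))
      ≈⟨ solve 6 (λ x y z w p q → # 0 :* x :* y :+ p :+ (q :+ z :* (# 0 :* w)) := p :+ q) refl
           (a 0) (b (suc n)) (a (suc n)) (b 0) (conv (λ i → fromℕ (suc i) * a (suc i)) b n)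
           (conv a (λ j → fromℕ (suc j) * b (suc j)) n) ⟩
    conv (λ i → fromℕ (suc i) * a (suc i)) b n + conv a (λ j → fromℕ (suc j) * b (suc j)) n
      ≈⟨ +-cong (conv-cong (expTerm-suc s) (λ _ → refl) n) (conv-cong (λ _ → refl) (expTerm-suc t) n) ⟩
    conv (λ i → s * a i) b n + conv a (λ j → t * b j) n
      ≈⟨ +-cong (conv-scaleˡ s a b n) (conv-scaleʳ t a b n) ⟩
    s * conv a b n + t * conv a b n
      ≈⟨ distribʳ _ _ _ ⟨
    (s + t) * conv a b n
      ≈⟨ *-congˡ (conv-expTerm s t n) ⟩
    (s + t) * expTerm (s + t) n
      ≈⟨ expTerm-suc (s + t) n ⟨
    fromℕ (suc n) * expTerm (s + t) (suc n) ∎)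
    where
    a = expTerm s
    b = expTerm t

  expSum : ℝ → ℕ → ℝ
  expSum t = partialSum (expTerm t)

  triangle-expTerm : ∀ s t n → triangle (expTerm s) (expTerm t) n ≈ expSum (s + t) n
  triangle-expTerm s t n = trans (triangle≈partialSum-conv _ _ n) (partialSum-cong (conv-expTerm s t) n)

  expSum-step : ∀ {t} → 0# ≤ t → ∀ n → expSum t n ≤ expSum t (suc n)
  expSum-step p = partialSum-step (expTerm-nonNeg p)

  -- From an index `N ≥ 2t` on, each term is at most half its predecessor. Hence the partial sum
  -- plus twice the next term never increases from there on, and its value at `N` bounds everything.
  expSum-bounded : ∀ {t} → 0# ≤ t → ∃[ u ] (∀ n → expSum t n ≤ u)
  expSum-bounded {t} 0≤t with archimedean (t + t)
  ... | N , 2t≤N = bound 0 , λ n → ≤-trans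
      (monotone (expSum t) (expSum-step 0≤t) (ℕ.m≤m+n n N))
      (≤-trans (≤-by (+-nonNeg (expTerm-nonNeg 0≤t (n ℕ.+ N)) (expTerm-nonNeg 0≤t (n ℕ.+ N))) refl) (bound-decreasing n))
    where
    bound : ℕ → ℝ
    bound k = expSum t (k ℕ.+ N) + (expTerm t (k ℕ.+ N) + expTerm t (k ℕ.+ N))

    halving : ∀ {n} → N ℕ.≤ n → expTerm t (suc n) + expTerm t (suc n) ≤ expTerm t n
    halving {n} N≤n = *-cancelˡ-≤ (fromℕ (suc n)) (0<fromℕ-suc n) (≤-resp
      (begin
        (t + t) * expTerm t n
          ≈⟨ solve 2 (λ t x → (t :+ t) :* x := t :* x :+ t :* x) refl t (expTerm t n) ⟩
        t * expTerm t n + t * expTerm t n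
          ≈⟨ +-cong (expTerm-suc t n) (expTerm-suc t n) ⟨
        fromℕ (suc n) * expTerm t (suc n) + fromℕ (suc n) * expTerm t (suc n)
          ≈⟨ distribˡ _ _ _ ⟨
        fromℕ (suc n) * (expTerm t (suc n) + expTerm t (suc n)) ∎)
      refl
      (*-mono-≤ (+-nonNeg 0≤t 0≤t) (expTerm-nonNeg 0≤t n)
        (≤-trans 2t≤N (fromℕ-mono-≤ (ℕ.m≤n⇒m≤1+n N≤n))) ≤-refl))

    bound-decreasing : ∀ k → bound k ≤ bound 0
    bound-decreasing zero    = ≤-refl
    bound-decreasing (suc k) = ≤-trans
      (≤-by (0≤y-x (halving (ℕ.m≤n+m N k)))
        (solve 3 (λ s x y → s :+ x :+ (y :+ y) :+ (x :- (y :+ y)) := s :+ (x :+ x)) refl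
          (expSum t (k ℕ.+ N)) (expTerm t (k ℕ.+ N)) (expTerm t (suc k ℕ.+ N))))
      (bound-decreasing k)

  -- `exp t` is a definite description and might be the junk value until some limit `L` has been
  -- exhibited.
  exp-limit : ∀ t {L} → IsLimit (expSum t) L → IsLimit (expSum t) (exp t)
  exp-limit t {L} lim = limit-resp (sum≈partialSum (expTerm t))
    (the-satisfies (IsLimit λ n → sum {n} λ k → expTerm t (toℕ k)) (L , limit-resp (sym ∘ sum≈partialSum (expTerm t)) lim))

  exp-unique : ∀ t {L} → IsLimit (expSum t) L → exp t ≈ L
  exp-unique t lim = limit-cong (λ _ → refl) (exp-limit t lim) lim

  lub-cong : ∀ {S s s′} → s ≈ s′ → IsLeastUpperBound S s → IsLeastUpperBound S s′
  lub-cong p (upper , least) = (λ y y∈S → ≤-respʳ-≈ p (upper y y∈S)) , λ u b → ≤-respˡ-≈ p (least u b)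

  exp-lub : ∀ {t} → 0# ≤ t → IsLeastUpperBound (Range (expSum t)) (exp t)
  exp-lub {t} p with expSum-bounded p
  ... | u , bounded with complete (Range (expSum t)) (0# , 0 , refl) (u , λ { y (n , e) → ≤-respˡ-≈ (sym e) (bounded n) })
  ...   | s , lub = lub-cong (sym (exp-unique t (monotone-limit (expSum-step p) lub))) lub

  expSum≤exp : ∀ {t} → 0# ≤ t → ∀ n → expSum t n ≤ exp t
  expSum≤exp {t} p n = proj₁ (exp-lub p) (expSum t n) (n , refl)

  exp≤ : ∀ {t u} → 0# ≤ t → (∀ n → expSum t n ≤ u) → exp t ≤ u
  exp≤ p q = proj₂ (exp-lub p) _ λ { y (n , e) → ≤-respˡ-≈ (sym e) (q n) }

  1≤exp : ∀ {t} → 0# ≤ t → 1# ≤ exp t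
  1≤exp {t} p = ≤-trans (≤-reflexive (sym (trans (+-identityˡ _) (expTerm-0 t)))) (expSum≤exp p 1)

  expSum-0 : ∀ {t} → t ≈ 0# → ∀ n → expSum t (suc n) ≈ 1#
  expSum-0 {t} p zero = trans (+-identityˡ _) (expTerm-0 t)
  expSum-0 {t} p (suc n) = begin
    expSum t (suc n) + t * t ^ n * i     ≈⟨ +-cong (expSum-0 p n) (*-congʳ (*-congʳ p)) ⟩
    1# + 0# * t ^ n * i                  ≈⟨ solve 2 (λ x y → # 1 :+ # 0 :* x :* y := # 1) refl (t ^ n) i ⟩
    1#                                   ∎
    where i = fromℕ (suc n !) ⁻¹

  expSum-neg-within : ∀ {t} → 0# ≤ t → ∀ n → expSum (- t) n within expSum t n
  expSum-neg-within p = partialSum-within (expTerm-neg-within p)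

  -- The triangle of this product is a partial sum of the series at `t - t`, hence 1. What lies
  -- outside the triangle is dominated by its analogue with `t` in place of `- t`, which is at most
  -- a tail of the series at `2t`.
  expSum-product-within : ∀ {t} → 0# ≤ t → ∀ n →
    expSum t (suc n) * expSum (- t) (suc n) - 1# within exp (t + t) - expSum (t + t) (suc n)
  expSum-product-within {t} p n = ≤-trans (proj₁ bound) square≤ , ≤-trans (proj₂ bound) square≤
    where
    N = suc n
    bound : expSum t N * expSum (- t) N - 1# within expSum t N * expSum t N - expSum (t + t) N
    bound = within-resp
      (+-congˡ (-‿cong (trans (triangle-expTerm t (- t) N) (expSum-0 (-‿inverseʳ t) n))))
      (+-congˡ (-‿cong (triangle-expTerm t t N)))
      (square-triangle-within (expTerm-nonNeg p)
        (λ k → within-self (expTerm-nonNeg p k))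
        (expTerm-neg-within p) (ℕ.≤-refl {N}))
    square≤ : expSum t N * expSum t N - expSum (t + t) N ≤ exp (t + t) - expSum (t + t) N
    square≤ = +-monoˡ-≤ _ (≤-trans (square≤triangle (expTerm-nonNeg p) (expTerm-nonNeg p) N N)
      (≤-respˡ-≈ (sym (triangle-expTerm t t (N ℕ.+ N))) (expSum≤exp (+-nonNeg p p) (N ℕ.+ N))))

  exp-neg-limit : ∀ {t c} → 0# ≤ t → exp t * c ≈ 1# → IsLimit (expSum (- t)) c
  exp-neg-limit {t} {c} p ec≈1 ε 0<ε = suc (N₁ ℕ.⊔ N₂) , close
    where
    e   = exp t
    1≤e = 1≤exp p
    0<e = <-≤-trans 0<1 1≤e
    0≤2t = +-nonNeg p p
    δ   = ½ * ε
    0<δ = *-pos 0<½ 0<ε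
    -- The error `e - A` is going to be multiplied by `B`, which is bounded by `e`.
    δ/e = e ⁻¹ * δ
    near₁ = approach-sup (expSum-step 0≤2t) (exp-lub 0≤2t) δ 0<δ
    near₂ = approach-sup (expSum-step p) (exp-lub p) δ/e (*-pos (⁻¹-pos 0<e) 0<δ)
    N₁ = proj₁ near₁
    N₂ = proj₁ near₂
    close : ∀ n → suc (N₁ ℕ.⊔ N₂) ℕ.≤ n → ∣ expSum (- t) n - c ∣ < ε
    close (suc n) (ℕ.s≤s N≤n) = ≤-<-trans (∣x∣≤r (shrink (proj₁ bound)) (shrink (≤-respˡ-≈ flip (proj₂ bound)))) small
      where
      A = expSum t (suc n)
      B = expSum (- t) (suc n)
      r = exp (t + t) - expSum (t + t) (suc n)
      s = e - A
      0≤s = 0≤y-x (expSum≤exp p (suc n))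
      0≤r = 0≤y-x (expSum≤exp 0≤2t (suc n))
      r<δ = proj₂ near₁ (suc n) (ℕ.m≤n⇒m≤1+n (ℕ.≤-trans (ℕ.m≤m⊔n N₁ N₂) N≤n))
      s<δ/e = proj₂ near₂ (suc n) (ℕ.m≤n⇒m≤1+n (ℕ.≤-trans (ℕ.m≤n⊔m N₁ N₂) N≤n))
      B-within-e : B within e
      B-within-e = ≤-trans (proj₁ (expSum-neg-within p (suc n))) (expSum≤exp p (suc n))
                 , ≤-trans (proj₂ (expSum-neg-within p (suc n))) (expSum≤exp p (suc n))
      bound : e * (B - c) within r + s * e
      bound = within-resp (begin
          A * B - 1# + s * B            ≈⟨ +-congʳ (+-congˡ (-‿cong ec≈1)) ⟨
          A * B - e * c + s * B         ≈⟨ solve 4 (λ A B e c → A :* B :- e :* c :+ (e :- A) :* B := e :* (B :- c)) refl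
               A B e c ⟩
          e * (B - c)                   ∎) refl
        (within-+ (expSum-product-within p n) (within-* 0≤s
          (within-self 0≤s) B-within-e))
      flip : - (e * (B - c)) ≈ e * - (B - c)
      flip = solve 2 (λ e x → :- (e :* x) := e :* :- x) refl e (B - c)
      0≤r+se = +-nonNeg 0≤r (*-nonNeg 0≤s (<⇒≤ 0<e))
      shrink : ∀ {x} → e * x ≤ r + s * e → x ≤ r + s * e
      shrink q = *-cancelˡ-≤ e 0<e (≤-trans q (≤-respˡ-≈ (*-identityˡ _) (*-mono-≤ 0≤1 0≤r+se 1≤e ≤-refl)))
      small : r + s * e < ε
      small = <-by (+-pos (<⇒0<y-x r<δ) (*-nonNeg (<⇒≤ 0<e) (0≤y-x (proj₁ s<δ/e)))) (begin
        r + s * e + (δ - r + e * (e ⁻¹ * δ - s))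
          ≈⟨ solve 5 (λ r s e i d → r :+ s :* e :+ (d :- r :+ e :* (i :* d :- s)) := d :+ e :* i :* d) refl
               r s e (e ⁻¹) δ ⟩
        δ + e * e ⁻¹ * δ       ≈⟨ +-congˡ (*-congʳ (*-inverseʳ (>0⇒≉0 0<e))) ⟩
        δ + 1# * δ             ≈⟨ +-congˡ (*-identityˡ δ) ⟩
        δ + δ                  ≈⟨ ½+½ ε ⟩
        ε                      ∎)


  -- The exponential function and the logarithm

  expTerm-tangent : ∀ {a b} → 0# ≤ a → 0# ≤ b → ∀ k →
    expTerm a (suc k) + (b - a) * expTerm a k ≤ expTerm b (suc k)
  expTerm-tangent {a} {b} p q k = ≤-respˡ-≈ (begin
    i * (a ^ suc k + c * (b - a) * a ^ k)
      ≈⟨ solve 5 (λ i A c d B → i :* (A :+ c :* d :* B) := A :* i :+ d :* (B :* (c :* i))) refl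
           i (a ^ suc k) c (b - a) (a ^ k) ⟩
    a ^ suc k * i + (b - a) * (a ^ k * (c * i))
      ≈⟨ +-congˡ (*-congˡ (*-congˡ (factorial-inverse k))) ⟩
    expTerm a (suc k) + (b - a) * expTerm a k ∎)
    (≤-respʳ-≈ (*-comm i (b ^ suc k)) (*-monoʳ-≤ i (<⇒≤ (⁻¹-pos (0<fromℕ-! (suc k)))) (bernoulli k p q)))
    where
    c = fromℕ (suc k)
    i = fromℕ (suc k !) ⁻¹

  -- The derivative of `expSum a (suc n)` is `expSum a n`, hence the two different lengths; the
  -- polynomial is convex on the non-negative half-line.
  expSum-tangent : ∀ {a b} → 0# ≤ a → 0# ≤ b → ∀ n →
    expSum a (suc n) + (b - a) * expSum a n ≤ expSum b (suc n)
  expSum-tangent {a} {b} p q zero = ≤-reflexive (trans (+-congˡ (zeroʳ (b - a))) (+-identityʳ _))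
  expSum-tangent {a} {b} p q (suc n) = ≤-respˡ-≈
    (solve 5 (λ s x d r y → s :+ d :* r :+ (x :+ d :* y) := s :+ x :+ d :* (r :+ y)) refl
      (expSum a (suc n)) (expTerm a (suc n)) (b - a) (expSum a n) (expTerm a n))
    (+-mono-≤ (expSum-tangent p q n) (expTerm-tangent p q n))

  exp-tangent-nonNeg : ∀ {a b} → 0# ≤ a → 0# ≤ b → exp a * (1# + (b - a)) ≤ exp b
  exp-tangent-nonNeg {a} {b} p q = [ increasing , decreasing ]′ (total a b)
    where
    -- The factor `k = 1 + (b - a)` is positive here, so each partial sum at `a` is at most
    -- `exp b / k`, and the supremum inherits the bound.
    increasing : a ≤ b → exp a * (1# + (b - a)) ≤ exp b
    increasing a≤b = ≤-resp (*-comm k (exp a)) k*k⁻¹*exp-b (*-monoʳ-≤ k (<⇒≤ 0<k) (exp≤ p λ n →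
      *-cancelˡ-≤ k 0<k (≤-trans (≤-by (expTerm-nonNeg p n)
          (solve 4 (λ s x a b → (# 1 :+ (b :- a)) :* s :+ x := s :+ x :+ (b :- a) :* s) refl (expSum a n) (expTerm a n) a b))
        (≤-respʳ-≈ (sym k*k⁻¹*exp-b) (≤-trans (expSum-tangent p q n) (expSum≤exp q (suc n)))))))
      where
      k = 1# + (b - a)
      0<k = +-pos 0<1 (0≤y-x a≤b)
      k*k⁻¹*exp-b : k * (k ⁻¹ * exp b) ≈ exp b
      k*k⁻¹*exp-b = trans (sym (*-assoc _ _ _)) (trans (*-congʳ (*-inverseʳ (>0⇒≉0 0<k))) (*-identityˡ _))
    -- The factor may be negative here. With `(a - b) exp a` moved to the other side, an upper bound
    -- on the partial sums at `a` is again all that is required.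
    decreasing : b ≤ a → exp a * (1# + (b - a)) ≤ exp b
    decreasing b≤a = ≤-by (0≤y-x upper)
      (solve 4 (λ a b e f → e :* (# 1 :+ (b :- a)) :+ (f :+ (a :- b) :* e :- e) := f) refl a b (exp a) (exp b))
      where
      upper : exp a ≤ exp b + (a - b) * exp a
      upper = exp≤ p λ n → ≤-trans (expSum-step p n) (≤-by
        (+-nonNeg (0≤y-x (≤-trans (expSum-tangent p q n) (expSum≤exp q (suc n))))
                  (*-nonNeg (0≤y-x b≤a) (0≤y-x (expSum≤exp p n))))
        (solve 6 (λ a b e f s t → t :+ (f :- (t :+ (b :- a) :* s) :+ (a :- b) :* (e :- s)) := f :+ (a :- b) :* e) refl
          a b (exp a) (exp b) (expSum a n) (expSum a (suc n))))

  neg-involutive : ∀ x → - - x ≈ x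
  neg-involutive = solve 1 (λ x → :- :- x := x) refl

  expSum-cong : ∀ {s t} → s ≈ t → ∀ n → expSum s n ≈ expSum t n
  expSum-cong p = partialSum-cong (expTerm-cong p)

  0≤- : ∀ {x} → x ≤ 0# → 0# ≤ - x
  0≤- p = ≤-respʳ-≈ (+-identityˡ _) (0≤y-x p)

  exp-reciprocal : ∀ {t} → 0# ≤ t → exp t * exp t ⁻¹ ≈ 1#
  exp-reciprocal p = *-inverseʳ (>0⇒≉0 (<-≤-trans 0<1 (1≤exp p)))

  exp-converges : ∀ t → ∃ (IsLimit (expSum t))
  exp-converges t = [ (λ 0≤t → exp t , monotone-limit (expSum-step 0≤t) (exp-lub 0≤t))
                    , (λ t≤0 → exp (- t) ⁻¹ , limit-resp (expSum-cong (neg-involutive t))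
                                                (exp-neg-limit (0≤- t≤0) (exp-reciprocal (0≤- t≤0))))
                    ]′ (total 0# t)

  exp-cong : ∀ {s t} → s ≈ t → exp s ≈ exp t
  exp-cong {s} {t} p = exp-unique s (limit-resp (expSum-cong (sym p)) (exp-limit t (proj₂ (exp-converges t))))

  exp*exp-neg-nonNeg : ∀ {t} → 0# ≤ t → exp t * exp (- t) ≈ 1#
  exp*exp-neg-nonNeg {t} p = trans (*-congˡ (exp-unique (- t) (exp-neg-limit p (exp-reciprocal p)))) (exp-reciprocal p)

  exp-neg*exp-nonPos : ∀ {t} → t ≤ 0# → exp (- t) * exp t ≈ 1#
  exp-neg*exp-nonPos {t} p = trans (*-congˡ (exp-cong (sym (neg-involutive t)))) (exp*exp-neg-nonNeg (0≤- p))

  exp-0 : exp 0# ≈ 1#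
  exp-0 = antisym (exp≤ ≤-refl bound) (1≤exp ≤-refl)
    where
    bound : ∀ n → expSum 0# n ≤ 1#
    bound zero    = 0≤1
    bound (suc n) = ≤-reflexive (expSum-0 refl n)

  exp-pos : ∀ t → 0# < exp t
  exp-pos t = [ (λ 0≤t → <-≤-trans 0<1 (1≤exp 0≤t)) , nonPos ]′ (total 0# t)
    where
    nonPos : t ≤ 0# → 0# < exp t
    nonPos t≤0 = [ (λ e≤0 → ⊥-elim (<⇒≱ 0<1 (≤-resp (exp-neg*exp-nonPos t≤0) (zeroʳ (exp (- t)))
                     (*-monoʳ-≤ (exp (- t)) (≤-trans 0≤1 (1≤exp (0≤- t≤0))) e≤0))))
                 , (λ 0<e → 0<e) ]′ (≤⊎> (exp t) 0#)

  1+x≤exp-nonNeg : ∀ {t} → 0# ≤ t → 1# + t ≤ exp t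
  1+x≤exp-nonNeg {t} p = ≤-respˡ-≈ (trans (*-congʳ exp-0) (solve 1 (λ t → # 1 :* (# 1 :+ (t :- # 0)) := # 1 :+ t) refl t))
    (exp-tangent-nonNeg ≤-refl p)

  exp*[1-t]≤1 : ∀ {t} → 0# ≤ t → exp t * (1# - t) ≤ 1#
  exp*[1-t]≤1 {t} p = ≤-resp (*-congˡ (+-congˡ (+-identityˡ (- t)))) exp-0 (exp-tangent-nonNeg p ≤-refl)

  -- With exp-0 and exp-pos this replaces the addition theorem in all that follows.
  exp-tangent : ∀ a b → exp a * (1# + (b - a)) ≤ exp b
  exp-tangent a b = [ (λ 0≤a → [ exp-tangent-nonNeg 0≤a , nonNeg-nonPos 0≤a ]′ (total 0# b))
                    , (λ a≤0 → [ nonPos-nonNeg a≤0 , nonPos-nonPos a≤0 ]′ (total 0# b)) ]′ (total 0# a)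
    where
    p = - a
    q = - b
    0≤e^a = <⇒≤ (exp-pos a)

    -- Multiplied by `exp p * exp q`, the claim becomes the tangent inequality at `q` evaluated at
    -- `p`: reflection exchanges the two points.
    nonPos-nonPos : a ≤ 0# → b ≤ 0# → exp a * (1# + (b - a)) ≤ exp b
    nonPos-nonPos a≤0 b≤0 = *-cancelˡ-≤ (exp p * exp q) (*-pos (exp-pos p) (exp-pos q)) (≤-resp
      (begin
        exp q * (1# + (p - q))                               ≈⟨ *-identityˡ _ ⟨
        1# * (exp q * (1# + (p - q)))                        ≈⟨ *-congʳ (exp-neg*exp-nonPos a≤0) ⟨
        exp p * exp a * (exp q * (1# + (p - q)))
          ≈⟨ solve 5 (λ P A Q a b → P :* A :* (Q :* (# 1 :+ (:- a :- :- b))) := P :* Q :* (A :* (# 1 :+ (b :- a)))) refl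
               (exp p) (exp a) (exp q) a b ⟩
        exp p * exp q * (exp a * (1# + (b - a)))             ∎)
      (begin
        exp p                          ≈⟨ *-identityʳ _ ⟨
        exp p * 1#                     ≈⟨ *-congˡ (exp-neg*exp-nonPos b≤0) ⟨
        exp p * (exp q * exp b)        ≈⟨ *-assoc _ _ _ ⟨
        exp p * exp q * exp b          ∎)
      (exp-tangent-nonNeg (0≤- b≤0) (0≤- a≤0)))

    -- Here `1 + (b - a) ≤ (1 - a) (1 + b) ≤ exp (- a) * exp b`.
    nonPos-nonNeg : a ≤ 0# → 0# ≤ b → exp a * (1# + (b - a)) ≤ exp b
    nonPos-nonNeg a≤0 0≤b = *-cancelˡ-≤ (exp p) (exp-pos p) (≤-respˡ-≈
      (begin
        1# + (b - a)                               ≈⟨ *-identityˡ _ ⟨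
        1# * (1# + (b - a))                        ≈⟨ *-congʳ (exp-neg*exp-nonPos a≤0) ⟨
        exp p * exp a * (1# + (b - a))             ≈⟨ *-assoc _ _ _ ⟩
        exp p * (exp a * (1# + (b - a)))           ∎)
      (≤-trans (≤-by (*-nonNeg (0≤- a≤0) 0≤b)
          (solve 2 (λ a b → # 1 :+ (b :- a) :+ (:- a :* b) := (# 1 :+ :- a) :* (# 1 :+ b)) refl a b))
        (*-mono-≤ (+-nonNeg 0≤1 (0≤- a≤0)) (<⇒≤ (exp-pos b)) (1+x≤exp-nonNeg (0≤- a≤0)) (1+x≤exp-nonNeg 0≤b))))

    -- A non-negative factor `1 + (b - a)` is at most `(1 - a) (1 + b)`; then `exp a * (1 - a) ≤ 1`
    -- and `exp (- b) * (1 + b) ≤ 1` apply separately.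
    nonNeg-nonPos : 0# ≤ a → b ≤ 0# → exp a * (1# + (b - a)) ≤ exp b
    nonNeg-nonPos 0≤a b≤0 =
      [ (λ 0≤k → *-cancelˡ-≤ (exp q) (exp-pos q) (≤-respʳ-≈ (sym (exp-neg*exp-nonPos b≤0)) (≤-trans
          (≤-by (*-nonNeg (*-nonNeg 0≤e^a (<⇒≤ (exp-pos q))) (*-nonNeg 0≤a (0≤- b≤0)))
            (solve 4 (λ A Q a b → Q :* (A :* (# 1 :+ (b :- a))) :+ A :* Q :* (a :* :- b) := A :* (# 1 :- a) :* (Q :* (# 1 :- :- b))) refl
              (exp a) (exp q) a b))
          (≤-respʳ-≈ (*-identityˡ 1#) (*-mono-≤
            (*-nonNeg 0≤e^a (≤-respʳ-≈ (solve 2 (λ a b → # 1 :+ (b :- a) :+ :- b := # 1 :- a) refl a b) (+-nonNeg 0≤k (0≤- b≤0))))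
            0≤1 (exp*[1-t]≤1 0≤a) (exp*[1-t]≤1 (0≤- b≤0)))))))
      , (λ k≤0 → ≤-trans (≤-respʳ-≈ (zeroʳ (exp a)) (*-monoʳ-≤ (exp a) 0≤e^a k≤0)) (<⇒≤ (exp-pos b)))
      ]′ (total 0# (1# + (b - a)))

  ≤⇒≈⊎< : ∀ {a b} → a ≤ b → a ≈ b ⊎ a < b
  ≤⇒≈⊎< {a} {b} p with em {a ≈ b}
  ... | yes q = inj₁ q
  ... | no ¬q = inj₂ (p , ¬q)

  exp-mono-< : ∀ {a b} → a < b → exp a < exp b
  exp-mono-< {a} {b} a<b = <-≤-trans
    (<-by (*-pos (exp-pos a) (<⇒0<y-x a<b)) (solve 3 (λ a b e → e :+ e :* (b :- a) := e :* (# 1 :+ (b :- a))) refl a b (exp a)))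
    (exp-tangent a b)

  exp-mono-≤ : ∀ {a b} → a ≤ b → exp a ≤ exp b
  exp-mono-≤ p = [ ≤-reflexive ∘ exp-cong , <⇒≤ ∘ exp-mono-< ]′ (≤⇒≈⊎< p)

  exp-cancel-< : ∀ {a b} → exp a < exp b → a < b
  exp-cancel-< {a} {b} p = [ (λ b≤a → ⊥-elim (<⇒≱ p (exp-mono-≤ b≤a))) , (λ a<b → a<b) ]′ (≤⊎> b a)

  exp-cancel-≤ : ∀ {a b} → exp a ≤ exp b → a ≤ b
  exp-cancel-≤ p = ≮⇒≥ λ b<a → <⇒≱ (exp-mono-< b<a) p

  1+x≤exp : ∀ t → 1# + t ≤ exp t
  1+x≤exp t = ≤-respˡ-≈ (trans (*-congʳ exp-0) (solve 1 (λ t → # 1 :* (# 1 :+ (t :- # 0)) := # 1 :+ t) refl t)) (exp-tangent 0# t)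

  -- The supremum `l` of all `y` with `exp y ≤ x` is the logarithm. Explicit steps `δ` read off from
  -- the tangent inequality take the place of continuity.
  exp-surjective : ∀ {x} → 0# < x → ∃[ y ] exp y ≈ x
  exp-surjective {x} 0<x = l , antisym (≮⇒≥ not-above) (≮⇒≥ not-below)
    where
    S : Pred ℝ 0ℓ
    S y = exp y ≤ x

    inhabited : Satisfiable S
    -- The tangent at `- 1/x` evaluated at 0 gives `exp (- 1/x) ≤ 1 / (1 + 1/x) = x / (x + 1) ≤ x`.
    inhabited = - x ⁻¹ , *-cancelˡ-≤ (1# + x ⁻¹) (+-pos 0<1 (<⇒≤ (⁻¹-pos 0<x)))
      (≤-trans (≤-resp (solve 2 (λ e i → e :* (# 1 :+ (# 0 :- :- i)) := (# 1 :+ i) :* e) refl (exp (- x ⁻¹)) (x ⁻¹)) exp-0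
                  (exp-tangent (- x ⁻¹) 0#))
               (≤-by (<⇒≤ 0<x) (begin
                  1# + x                  ≈⟨ +-congʳ (*-inverseʳ (>0⇒≉0 0<x)) ⟨
                  x * x ⁻¹ + x            ≈⟨ solve 2 (λ x i → x :* i :+ x := (# 1 :+ i) :* x) refl x (x ⁻¹) ⟩
                  (1# + x ⁻¹) * x         ∎)))

    bounded : IsUpperBound S x
    bounded y p = ≤-trans (≤-by 0≤1 (+-comm y 1#)) (≤-trans (1+x≤exp y) p)

    l-lub = complete S inhabited (x , bounded)
    l = proj₁ l-lub

    -- With δ = 1 - exp l / x, the tangent at l + δ gives exp (l + δ) ≤ exp l / (1 - δ) = x.
    not-below : ¬ (exp l < x)
    not-below p = <⇒≱ (<-by 0<δ refl) (proj₁ (proj₂ l-lub) (l + δ)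
        (*-cancelˡ-≤ (exp l) (exp-pos l) (≤-trans
          (≤-resp rewrite-tangent refl (*-monoʳ-≤ x (<⇒≤ 0<x) (exp-tangent (l + δ) l))) (≤-reflexive (*-comm x (exp l))))))
      where
      δ = (x - exp l) * x ⁻¹
      0<δ = *-pos (<⇒0<y-x p) (⁻¹-pos 0<x)
      rewrite-tangent : x * (exp (l + δ) * (1# + (l - (l + δ)))) ≈ exp l * exp (l + δ)
      rewrite-tangent = begin
        x * (exp (l + δ) * (1# + (l - (l + δ))))
          ≈⟨ solve 5 (λ x l e f i → x :* (f :* (# 1 :+ (l :- (l :+ (x :- e) :* i)))) := (x :- (x :- e) :* (x :* i)) :* f) refl
               x l (exp l) (exp (l + δ)) (x ⁻¹) ⟩
        (x - (x - exp l) * (x * x ⁻¹)) * exp (l + δ)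
          ≈⟨ *-congʳ (+-congˡ (-‿cong (*-congˡ (*-inverseʳ (>0⇒≉0 0<x))))) ⟩
        (x - (x - exp l) * 1#) * exp (l + δ)
          ≈⟨ *-congʳ (solve 2 (λ x e → x :- (x :- e) :* # 1 := e) refl x (exp l)) ⟩
        exp l * exp (l + δ) ∎

    not-above : ¬ (x < exp l)
    not-above p = <⇒≱ (<-by 0<δ (solve 2 (λ l d → l :- d :+ d := l) refl l δ))
        (proj₂ (proj₂ l-lub) (l - δ) λ y y∈S → exp-cancel-≤ (≤-trans y∈S x≤exp[l-δ]))
      where
      -- Chosen so that the tangent at `l` takes the value `exp l * (1 - δ) = x` at `l - δ`.
      δ = (exp l - x) * exp l ⁻¹
      0<δ = *-pos (<⇒0<y-x p) (⁻¹-pos (exp-pos l))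
      x≤exp[l-δ] : x ≤ exp (l - δ)
      x≤exp[l-δ] = ≤-respˡ-≈ (begin
        exp l * (1# + (l - δ - l))
          ≈⟨ solve 4 (λ x l e i → e :* (# 1 :+ (l :- (e :- x) :* i :- l)) := e :- (e :- x) :* (e :* i)) refl
               x l (exp l) (exp l ⁻¹) ⟩
        exp l - (exp l - x) * (exp l * exp l ⁻¹)
          ≈⟨ +-congˡ (-‿cong (*-congˡ (*-inverseʳ (>0⇒≉0 (exp-pos l))))) ⟩
        exp l - (exp l - x) * 1#
          ≈⟨ solve 2 (λ x e → e :- (e :- x) :* # 1 := x) refl x (exp l) ⟩
        x ∎) (exp-tangent l (l - δ))

  exp-log : ∀ {x} → 0# < x → exp (log x) ≈ x
  exp-log {x} 0<x = the-satisfies (λ y → exp y ≈ x) (exp-surjective 0<x)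

  -- For `x > 0` this is the tangent of `exp` at `log x`, evaluated at `s`. For `x = 0` the junk
  -- value of `log` is multiplied by 0 and `- exp s ≤ 0` remains.
  fenchel-young : ∀ {x} → 0# ≤ x → ∀ s → x + x * s - exp s ≤ x * log x
  fenchel-young {x} 0≤x s = [ zero-case ∘ sym , pos-case ]′ (≤⇒≈⊎< 0≤x)
    where
    zero-case : x ≈ 0# → x + x * s - exp s ≤ x * log x
    zero-case x≈0 = ≤-by (<⇒≤ (exp-pos s)) (begin
      x + x * s - exp s + exp s     ≈⟨ solve 3 (λ x s e → x :+ x :* s :- e :+ e := x :* (# 1 :+ s)) refl x s (exp s) ⟩
      x * (1# + s)                  ≈⟨ *-congʳ x≈0 ⟩
      0# * (1# + s)                 ≈⟨ zeroˡ _ ⟩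
      0#                            ≈⟨ zeroˡ _ ⟨
      0# * log x                    ≈⟨ *-congʳ x≈0 ⟨
      x * log x                     ∎)
    pos-case : 0# < x → x + x * s - exp s ≤ x * log x
    pos-case 0<x = ≤-by
      (0≤y-x (≤-respˡ-≈ (*-congʳ (exp-log 0<x)) (exp-tangent (log x) s)))
      (solve 4 (λ x s e l → x :+ x :* s :- e :+ (e :- x :* (# 1 :+ (s :- l))) := x :* l) refl x s (exp s) (log x))

  -- Each step uses the tangent at `(k + 1) v`, evaluated at `k v`, and so spends one factor
  -- `1 - v`. The quadratic `1 + u + u²` will be compared with three factors `1 - u/3`; two factors
  -- `1 - u/2` would fall short, since their product with the quadratic is `63/64` at `u = 1/2`.
  exp-multiple-bound : ∀ {v} → v ≤ 1# → ∀ k → exp (fromℕ k * v) * (1# - v) ^ k ≤ 1#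
  exp-multiple-bound {v} p zero = ≤-reflexive (trans (*-identityʳ _) (trans (exp-cong (zeroˡ v)) exp-0))
  exp-multiple-bound {v} p (suc k) = ≤-trans (≤-respˡ-≈
      (solve 5 (λ e k v K w → w :* (e :* (# 1 :+ (k :* v :- (# 1 :+ k) :* v))) := e :* ((# 1 :- v) :* w)) refl
        (exp (fromℕ (suc k) * v)) (fromℕ k) v (fromℕ (suc k)) ((1# - v) ^ k))
      (≤-respʳ-≈ (*-comm _ _) (*-monoʳ-≤ ((1# - v) ^ k) (^-nonNeg k (0≤y-x p)) (exp-tangent (fromℕ (suc k) * v) (fromℕ k * v)))))
    (exp-multiple-bound p k)

  -- (1 - v)³ (1 + 3v + 9v²) = 1 + v² ((1 - 6v) (3 - v) + 9v² (2 - v)).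
  exp≤quadratic^ : ∀ {v} → fromℕ 6 * v ≤ 1# → ∀ m →
    exp (fromℕ (m ℕ.* 3) * v) ≤ (1# + fromℕ 3 * v + fromℕ 9 * (v * v)) ^ m
  exp≤quadratic^ {v} 6v≤1 m = *-cancelˡ-≤ ((1# - v) ^ (m ℕ.* 3)) (^-pos (m ℕ.* 3) (<⇒0<y-x v<1)) (≤-trans
    (≤-respˡ-≈ (*-comm _ _) (exp-multiple-bound (<⇒≤ v<1) (m ℕ.* 3)))
    (≤-respʳ-≈ (begin
        ((1# - v) ^ 3 * q) ^ m                   ≈⟨ ^-distrib-* ((1# - v) ^ 3) q m ⟩
        ((1# - v) ^ 3) ^ m * q ^ m               ≈⟨ *-congʳ (^-assocʳ (1# - v) 3 m) ⟩
        (1# - v) ^ (3 ℕ.* m) * q ^ m             ≡⟨ ≡.cong (λ k → (1# - v) ^ k * q ^ m) (ℕ.*-comm 3 m) ⟩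
        (1# - v) ^ (m ℕ.* 3) * q ^ m             ∎)
      (1≤x^n m (≤-by
        (*-nonNeg (0≤x² v) (+-nonNeg (*-nonNeg (0≤y-x 6v≤1) 0≤3-v) (*-nonNeg (*-nonNeg (0≤fromℕ 9) (0≤x² v)) 0≤2-v)))
        (solve 1 (λ v → # 1 :+ v :* v :* ((# 1 :- # 6 :* v) :* (# 3 :- v) :+ # 9 :* (v :* v) :* (# 2 :- v))
                      := (# 1 :- v) :* ((# 1 :- v) :* ((# 1 :- v) :* # 1)) :* (# 1 :+ # 3 :* v :+ # 9 :* (v :* v))) refl v)))))
    where
    q = 1# + fromℕ 3 * v + fromℕ 9 * (v * v)
    v<1 : v < 1#
    v<1 with ≤⊎> 1# v
    ... | inj₂ r = r
    ... | inj₁ 1≤v = ⊥-elim (<⇒≱ (0<fromℕ 5) (≤-by (+-nonNeg (0≤y-x 6v≤1) (*-nonNeg (0≤fromℕ 6) (0≤y-x 1≤v)))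
                       (solve 1 (λ v → # 5 :+ (# 1 :- # 6 :* v :+ # 6 :* (v :- # 1)) := # 0) refl v)))
    0≤3-v : 0# ≤ fromℕ 3 - v
    0≤3-v = ≤-respʳ-≈ (solve 1 (λ v → # 1 :- v :+ # 2 := # 3 :- v) refl v) (+-nonNeg (0≤y-x (<⇒≤ v<1)) (0≤fromℕ 2))
    0≤2-v : 0# ≤ fromℕ 2 - v
    0≤2-v = ≤-respʳ-≈ (solve 1 (λ v → # 1 :- v :+ # 1 := # 2 :- v) refl v) (+-nonNeg (0≤y-x (<⇒≤ v<1)) 0≤1)

  exp[-3]<1 : exp (- fromℕ 3) < 1#
  exp[-3]<1 = <-resp refl exp-0 (exp-mono-< (<-by (0<fromℕ 3) (solve 0 (:- # 3 :+ # 3 := # 0) refl)))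

  -- Lets the additive constant in the degree be charged to the `O`-term. From `η < e⁻³` follows
  -- `l > 3`, so `k = log l` is positive, and `k ≤ exp k = l`.
  1≤log/loglog : ∀ {η} → 0# < η → η < exp (- fromℕ 3) → 1# ≤ log (η ⁻¹) * log (log (η ⁻¹)) ⁻¹
  1≤log/loglog {η} 0<η η<exp[-3] = *-cancelˡ-≤ k 0<k (≤-resp (sym (*-identityʳ k)) k-cancels k≤l)
    where
    l = log (η ⁻¹)
    k = log l
    exp-l : exp l ≈ η ⁻¹
    exp-l = exp-log (⁻¹-pos 0<η)
    3<l : fromℕ 3 < l
    3<l = [ (λ l≤3 → ⊥-elim (<⇒≱ η<exp[-3] (*-cancelˡ-≤ (exp (fromℕ 3)) (exp-pos _) (≤-resp
        (begin
          η * exp l                              ≈⟨ *-congˡ exp-l ⟩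
          η * η ⁻¹                               ≈⟨ *-inverseʳ (>0⇒≉0 0<η) ⟩
          1#                                     ≈⟨ exp*exp-neg-nonNeg (0≤fromℕ 3) ⟨
          exp (fromℕ 3) * exp (- fromℕ 3)        ∎)
        (*-comm η (exp (fromℕ 3)))
        (*-monoʳ-≤ η (<⇒≤ 0<η) (exp-mono-≤ l≤3))))))
      , (λ p → p) ]′ (≤⊎> l (fromℕ 3))
    1<l : 1# < l
    1<l = ≤-<-trans (≤-by (0≤fromℕ 2) refl) 3<l
    0<l = ≤-<-trans 0≤1 1<l
    exp-k : exp k ≈ l
    exp-k = exp-log 0<l
    0<k : 0# < k
    0<k = exp-cancel-< (<-resp (sym exp-0) (sym exp-k) 1<l)
    k≤l : k ≤ l
    k≤l = ≤-trans (≤-by 0≤1 (+-comm k 1#)) (≤-respʳ-≈ exp-k (1+x≤exp k))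
    k-cancels : l ≈ k * (l * k ⁻¹)
    k-cancels = begin
      l                    ≈⟨ *-identityʳ l ⟨
      l * 1#               ≈⟨ *-congˡ (*-inverseʳ (>0⇒≉0 0<k)) ⟨
      l * (k * k ⁻¹)       ≈⟨ solve 3 (λ l k i → l :* (k :* i) := k :* (l :* i)) refl l k (k ⁻¹) ⟩
      k * (l * k ⁻¹)       ∎

  -- Expectations and norms

  module Expectation (Ω : FiniteProbabilitySpace) where
    open FiniteProbabilitySpace Ω
    open SemiringSum (CommutativeRing.semiring commutativeRing) using (*-distribˡ-sum; sum-cong-≋; ∑-distrib-+)

    ∑-cong : ∀ {g h : X → ℝ} → (∀ x → g x ≈ h x) → ∑ g ≈ ∑ h
    ∑-cong {g} {h} p = sum-cong-≋ {size} {g ∘ Inverse.to enumeration} {h ∘ Inverse.to enumeration} λ i → p (Inverse.to enumeration i)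

    sum-nonNeg : ∀ {n} (a : Fin n → ℝ) → (∀ i → 0# ≤ a i) → 0# ≤ sum a
    sum-nonNeg {zero}  a p = ≤-refl
    sum-nonNeg {suc n} a p = +-nonNeg (p zero) (sum-nonNeg (a ∘ suc) (p ∘ suc))

    -- Opaque, so that unification can read off h from E h.
    opaque
      E : (X → ℝ) → ℝ
      E = 𝔼 Ω

      E≈𝔼 : ∀ h → E h ≈ 𝔼 Ω h
      E≈𝔼 h = refl

      E-cong : ∀ {g h} → (∀ x → g x ≈ h x) → E g ≈ E h
      E-cong p = ∑-cong λ x → *-congˡ {μ x} (p x)

      E-+ : ∀ g h → E (λ x → g x + h x) ≈ E g + E h
      E-+ g h = trans (∑-cong λ x → distribˡ (μ x) (g x) (h x)) (∑-distrib-+ {size} _ _)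

      E-scale : ∀ c h → E (λ x → c * h x) ≈ c * E h
      E-scale c h = trans (∑-cong λ x → solve 3 (λ m c h → m :* (c :* h) := c :* (m :* h)) refl (μ x) c (h x))
                          (sym (*-distribˡ-sum {size} c _))

      E-1 : E (λ _ → 1#) ≈ 1#
      E-1 = trans (∑-cong λ x → *-identityʳ (μ x)) μ-total

      E-nonNeg : ∀ {h} → (∀ x → 0# ≤ h x) → 0# ≤ E h
      E-nonNeg {h} p = sum-nonNeg {size} (λ i → μ (Inverse.to enumeration i) * h (Inverse.to enumeration i))
                                  λ i → *-nonNeg (μ-nonNeg _) (p _)

    E-const : ∀ c → E (λ _ → c) ≈ c
    E-const c = trans (E-cong λ _ → sym (*-identityʳ c)) (trans (E-scale c (λ _ → 1#)) (trans (*-congˡ E-1) (*-identityʳ c)))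

    E-sub : ∀ g h → E (λ x → g x - h x) ≈ E g - E h
    E-sub g h = begin
      E (λ x → g x - h x)                  ≈⟨ E-cong (λ x → solve 2 (λ g h → g :- h := g :+ (:- # 1) :* h) refl
           (g x) (h x)) ⟩
      E (λ x → g x + (- 1#) * h x)         ≈⟨ E-+ g _ ⟩
      E g + E (λ x → (- 1#) * h x)         ≈⟨ +-congˡ (E-scale (- 1#) h) ⟩
      E g + (- 1#) * E h                   ≈⟨ solve 2 (λ g h → g :+ (:- # 1) :* h := g :- h) refl (E g) (E h) ⟩
      E g - E h                            ∎

    E-mono-≤ : ∀ {g h} → (∀ x → g x ≤ h x) → E g ≤ E h
    E-mono-≤ {g} {h} p = ≤-by (≤-respʳ-≈ (E-sub h g) (E-nonNeg (0≤y-x ∘ p)))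
      (solve 2 (λ g h → g :+ (h :- g) := h) refl (E g) (E h))

    finite-bounded : ∀ {n} (a : Fin n → ℝ) → ∃[ u ] (∀ i → a i ≤ u)
    finite-bounded {zero}  a = 0# , λ ()
    finite-bounded {suc n} a with finite-bounded (a ∘ suc)
    ... | u , p = a zero ⊔ u , λ { zero → x≤x⊔y _ _ ; (suc i) → ≤-trans (p i) (y≤x⊔y _ _) }

    ∣φ∣≤‖φ‖∞ : ∀ φ x → ∣ φ x ∣ ≤ ‖ Ω ‖∞ φ
    ∣φ∣≤‖φ‖∞ φ x = proj₁ (sup-isLeastUpperBound S (∣ φ x ∣ , x , refl) bounded) ∣ φ x ∣ (x , refl)
      where
      S : Pred ℝ 0ℓ
      S y = ∃[ x ] y ≈ ∣ φ x ∣
      bounded : ∃ (IsUpperBound S)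
      bounded with finite-bounded {size} (λ i → ∣ φ (Inverse.to enumeration i) ∣)
      ... | u , p = u , λ { y (x , e) → ≤-respˡ-≈ (sym (trans e (reflexive
                      (≡.cong (∣_∣ ∘ φ) (≡.sym (Inverse.strictlyInverseˡ enumeration x)))))) (p (Inverse.from enumeration x)) }

    SupNormAtMost⇒∣φ∣≤ : ∀ {F c} → SupNormAtMost Ω F c → ∀ {φ} → φ ∈ F → ∀ x → ∣ φ x ∣ ≤ c
    SupNormAtMost⇒∣φ∣≤ (s , (upper , _) , s≤c) {φ} φ∈F x =
      ≤-trans (∣φ∣≤‖φ‖∞ φ x) (≤-trans (upper (‖ Ω ‖∞ φ) (φ , φ∈F , refl)) s≤c)

    dualNorm≤ : ∀ {F h c} → Satisfiable F → (∀ {φ} → φ ∈ F → ∣ ⟪ Ω , φ ⟫ h ∣ ≤ c) → dualNorm Ω F h ≤ c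
    dualNorm≤ {F} {h} {c} (φ , φ∈F) p =
      proj₂ (sup-isLeastUpperBound S (∣ ⟪ Ω , φ ⟫ h ∣ , φ , φ∈F , refl) (c , upper)) c upper
      where
      S : Pred ℝ 0ℓ
      S y = ∃[ φ ] φ ∈ F × y ≈ ∣ ⟪ Ω , φ ⟫ h ∣
      upper : IsUpperBound S c
      upper y (φ , φ∈F , e) = ≤-respˡ-≈ (sym e) (p φ∈F)

  -- Riesz products and their non-negative combinations

  module RieszCombinations (Ω : FiniteProbabilitySpace) (F : Pred (FiniteProbabilitySpace.X Ω → ℝ) 0ℓ)
    (F-inhabited : Satisfiable F) where
    open FiniteProbabilitySpace Ω

    IsSign : ℝ → Set
    IsSign e = e ≈ - 1# ⊎ e ≈ 0# ⊎ e ≈ 1#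

    -- Unlike IsRieszProduct, degree 0 is allowed here.
    data Riesz : ℕ → (X → ℝ) → Set where
      one    : ∀ {R} → (∀ x → R x ≈ 1#) → Riesz 0 R
      factor : ∀ {d φ e R R′} → φ ∈ F → IsSign e → Riesz d R → (∀ x → R′ x ≈ (1# + e * φ x) * R x) → Riesz (suc d) R′

    -- An inductive counterpart of `IsNonNegCombination`: closure under sums and products becomes
    -- structural recursion. Each constructor carries a pointwise equation, which takes the place of
    -- function extensionality.
    data Comb (d : ℕ) : (X → ℝ) → Set where
      empty : ∀ {g} → (∀ x → g x ≈ 0#) → Comb d g
      term  : ∀ {c R g g′} → 0# ≤ c → Riesz d R → Comb d g → (∀ x → g′ x ≈ c * R x + g x) → Comb d g′

    riesz-cong : ∀ {d R R′} → (∀ x → R′ x ≈ R x) → Riesz d R → Riesz d R′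
    riesz-cong p (one q)          = one λ x → trans (p x) (q x)
    riesz-cong p (factor f s r q) = factor f s r λ x → trans (p x) (q x)

    riesz-* : ∀ {m n R R′} → Riesz m R → Riesz n R′ → Riesz (m ℕ.+ n) (λ x → R x * R′ x)
    riesz-* (one p) r′ = riesz-cong (λ x → trans (*-congʳ (p x)) (*-identityˡ _)) r′
    riesz-* (factor f s r p) r′ = factor f s (riesz-* r r′) λ x → trans (*-congʳ (p x)) (*-assoc _ _ _)

    -- All terms of a combination share one degree; factors with sign 0 pad the constant 1 to that
    -- degree.
    riesz-1 : ∀ d → Riesz d (λ _ → 1#)
    riesz-1 zero    = one λ _ → refl
    riesz-1 (suc d) = factor (proj₂ F-inhabited) (inj₂ (inj₁ refl)) (riesz-1 d)
      λ x → solve 1 (λ p → # 1 := (# 1 :+ # 0 :* p) :* # 1) refl (proj₁ F-inhabited x)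

    comb-cong : ∀ {d g g′} → (∀ x → g′ x ≈ g x) → Comb d g → Comb d g′
    comb-cong p (empty q)      = empty λ x → trans (p x) (q x)
    comb-cong p (term n r c q) = term n r c λ x → trans (p x) (q x)

    comb-scale : ∀ {d g k} → 0# ≤ k → Comb d g → Comb d (λ x → k * g x)
    comb-scale {k = k} 0≤k (empty p) = empty λ x → trans (*-congˡ (p x)) (zeroʳ k)
    comb-scale {k = k} 0≤k (term n r c p) = term (*-nonNeg 0≤k n) r (comb-scale 0≤k c)
      λ x → trans (*-congˡ (p x)) (solve 4 (λ k c r g → k :* (c :* r :+ g) := k :* c :* r :+ k :* g) refl k _ _ _)

    comb-+ : ∀ {d g h} → Comb d g → Comb d h → Comb d (λ x → g x + h x)
    comb-+ (empty p)      c′ = comb-cong (λ x → trans (+-congʳ (p x)) (+-identityˡ _)) c′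
    comb-+ (term n r c p) c′ = term n r (comb-+ c c′) λ x → trans (+-congʳ (p x)) (+-assoc _ _ _)

    riesz-*-comb : ∀ {m n R g} → Riesz m R → Comb n g → Comb (m ℕ.+ n) (λ x → R x * g x)
    riesz-*-comb r (empty p) = empty λ x → trans (*-congˡ (p x)) (zeroʳ _)
    riesz-*-comb r (term n r′ c p) = term n (riesz-* r r′) (riesz-*-comb r c)
      λ x → trans (*-congˡ (p x)) (solve 4 (λ r k r′ g → r :* (k :* r′ :+ g) := k :* (r :* r′) :+ r :* g) refl _ _ _ _)

    comb-* : ∀ {m n g h} → Comb m g → Comb n h → Comb (m ℕ.+ n) (λ x → g x * h x)
    comb-* (empty p)      c′ = empty λ x → trans (*-congʳ (p x)) (zeroˡ _)
    comb-* (term n r c p) c′ = comb-cong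
      (λ x → trans (*-congʳ (p x)) (solve 4 (λ k r g h → (k :* r :+ g) :* h := k :* (r :* h) :+ g :* h) refl _ _ _ _))
      (comb-+ (comb-scale n (riesz-*-comb r c′)) (comb-* c c′))

    comb-riesz : ∀ {d R} → Riesz d R → Comb d R
    comb-riesz r = term 0≤1 r (empty λ _ → refl) λ x → solve 1 (λ r → r := # 1 :* r :+ # 0) refl _

    comb-const : ∀ {d k} → 0# ≤ k → Comb d (λ _ → k)
    comb-const {d} p = comb-cong (λ _ → sym (*-identityʳ _)) (comb-scale p (comb-riesz (riesz-1 d)))

    comb-^ : ∀ {d q} n → Comb d q → Comb (n ℕ.* d) (λ x → q x ^ n)
    comb-^ zero    c = comb-const 0≤1
    comb-^ (suc n) c = comb-* c (comb-^ n c)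

    -- The data of `IsRieszProduct` without `d≥1`, so that the recursion can pass through degree 0.
    record RieszFactors (d : ℕ) (R : X → ℝ) : Set where
      field
        φ      : Fin d → X → ℝ
        φ∈F    : ∀ i → φ i ∈ F
        ε      : Fin d → ℝ
        ε-sign : ∀ i → IsSign (ε i)
        R≈∏    : ∀ x → R x ≈ product λ i → 1# + ε i * φ i x

    riesz⇒factors : ∀ {d R} → Riesz d R → RieszFactors d R
    riesz⇒factors (one p) = record { φ = λ () ; φ∈F = λ () ; ε = λ () ; ε-sign = λ () ; R≈∏ = p }
    riesz⇒factors (factor {φ = φ} {e} f s r p) with riesz⇒factors r
    ... | fs = record
      { φ      = φ ∷ RieszFactors.φ fs
      ; φ∈F    = λ { zero → f ; (suc i) → RieszFactors.φ∈F fs i }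
      ; ε      = e ∷ RieszFactors.ε fs
      ; ε-sign = λ { zero → s ; (suc i) → RieszFactors.ε-sign fs i }
      ; R≈∏    = λ x → trans (p x) (*-congˡ (RieszFactors.R≈∏ fs x))
      }

    riesz⇒isRieszProduct : ∀ {d R} → Riesz (suc d) R → IsRieszProduct Ω F (suc d) R
    riesz⇒isRieszProduct r = record { d≥1 = ℕ.s≤s ℕ.z≤n ; RieszFactors (riesz⇒factors r) }

    comb⇒isNonNegCombination : ∀ {d g} → Comb (suc d) g → IsNonNegCombination Ω (IsRieszProduct Ω F (suc d)) g
    comb⇒isNonNegCombination (empty p) = record
      { terms = 0 ; c = λ () ; c-nonNeg = λ () ; R = λ () ; R∈S = λ () ; g≈∑ = p }
    comb⇒isNonNegCombination (term {c = k} {R} n r c p) with comb⇒isNonNegCombination c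
    ... | tl = record
      { terms    = suc (IsNonNegCombination.terms tl)
      ; c        = k ∷ IsNonNegCombination.c tl
      ; c-nonNeg = λ { zero → n ; (suc j) → IsNonNegCombination.c-nonNeg tl j }
      ; R        = R ∷ IsNonNegCombination.R tl
      ; R∈S      = λ { zero → riesz⇒isRieszProduct r ; (suc j) → IsNonNegCombination.R∈S tl j }
      ; g≈∑      = λ x → trans (p x) (+-congˡ (IsNonNegCombination.g≈∑ tl x))
      }

  -- The variational problem and its first-order conditions

  module DualAscent (Ω : FiniteProbabilitySpace) (F : Pred (FiniteProbabilitySpace.X Ω → ℝ) 0ℓ)
    (F-inhabited : Satisfiable F) (F-bounded : ∀ {φ} → φ ∈ F → ∀ x → ∣ φ x ∣ ≤ 1#) where
    open FiniteProbabilitySpace Ω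
    open Expectation Ω
    open RieszCombinations Ω F F-inhabited

    sign-within : ∀ {e} → IsSign e → e within 1#
    sign-within (inj₁ p) = within-resp (sym p) refl
      (≤-by (+-nonNeg 0≤1 0≤1) (solve 0 (:- # 1 :+ (# 1 :+ # 1) := # 1) refl) , ≤-reflexive (solve 0 (:- :- # 1 := # 1) refl))
    sign-within (inj₂ (inj₁ p)) = within-resp (sym p) refl (0≤1 , ≤-respˡ-≈ (solve 0 (# 0 := :- # 0) refl) 0≤1)
    sign-within (inj₂ (inj₂ p)) = within-resp (sym p) refl
      (within-self 0≤1)

    signed-within : ∀ {e φ} → IsSign e → φ ∈ F → ∀ x → e * φ x within 1#
    signed-within {φ = φ} s φ∈F x = within-resp refl (*-identityˡ 1#) (within-* 0≤1 (sign-within s)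
      (≤-trans (x≤∣x∣ (φ x)) (F-bounded φ∈F x) , ≤-trans (-x≤∣x∣ (φ x)) (F-bounded φ∈F x)))

    0≤1+eφ : ∀ {e φ} → IsSign e → φ ∈ F → ∀ x → 0# ≤ 1# + e * φ x
    0≤1+eφ {e} {φ} s φ∈F x = ≤-respʳ-≈ (solve 2 (λ e p → # 1 :- :- (e :* p) := # 1 :+ e :* p) refl e (φ x))
      (0≤y-x (proj₂ (signed-within s φ∈F x)))

    1+eφ≤2 : ∀ {e φ} → IsSign e → φ ∈ F → ∀ x → 1# + e * φ x ≤ 1# + 1#
    1+eφ≤2 s φ∈F x = +-mono-≤ ≤-refl (proj₁ (signed-within s φ∈F x))

    -- The weight `T` is carried as an index because `w` need not determine it, while the penalty
    -- and the bound `w ≤ 2T` refer to it.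
    data Cone : (X → ℝ) → ℝ → Set where
      origin : Cone (λ _ → 0#) 0#
      extend : ∀ {φ e t w T} → φ ∈ F → IsSign e → 0# ≤ t → Cone w T → Cone (λ x → w x + t * (1# + e * φ x)) (T + t)

    cone-weight-nonNeg : ∀ {w T} → Cone w T → 0# ≤ T
    cone-weight-nonNeg origin             = ≤-refl
    cone-weight-nonNeg (extend _ _ 0≤t c) = +-nonNeg (cone-weight-nonNeg c) 0≤t

    cone-nonNeg : ∀ {w T} → Cone w T → ∀ x → 0# ≤ w x
    cone-nonNeg origin                 x = ≤-refl
    cone-nonNeg (extend φ∈F s 0≤t c) x = +-nonNeg (cone-nonNeg c x) (*-nonNeg 0≤t (0≤1+eφ s φ∈F x))

    cone-upper : ∀ {w T} → Cone w T → ∀ x → w x ≤ T + T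
    cone-upper origin x = ≤-reflexive (sym (+-identityˡ 0#))
    cone-upper (extend {t = t} {T = T} φ∈F s 0≤t c) x = ≤-respʳ-≈
      (solve 2 (λ T t → T :+ T :+ t :* (# 1 :+ # 1) := T :+ t :+ (T :+ t)) refl T t)
      (+-mono-≤ (cone-upper c x) (*-monoʳ-≤ t 0≤t (1+eφ≤2 s φ∈F x)))

    cone-comb : ∀ {w T} → Cone w T → Comb 1 w
    cone-comb origin = comb-const ≤-refl
    cone-comb (extend φ∈F s 0≤t c) = comb-+ (cone-comb c) (comb-scale 0≤t (comb-riesz
      (factor φ∈F s (one λ _ → refl) λ x → sym (*-identityʳ _))))

    record State : Set where
      field
        a    : ℝ
        w    : X → ℝ
        T    : ℝ
        cone : Cone w T
        0≤a  : 0# ≤ a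
        a+2T≤2 : a + (T + T) ≤ fromℕ 2

      y : X → ℝ
      y x = a + w x

      0≤y : ∀ x → 0# ≤ y x
      0≤y x = +-nonNeg 0≤a (cone-nonNeg cone x)

      a≤y : ∀ x → a ≤ y x
      a≤y x = ≤-by (cone-nonNeg cone x) refl

      y≤a+2T : ∀ x → y x ≤ a + (T + T)
      y≤a+2T x = +-mono-≤ ≤-refl (cone-upper cone x)

      y≤2 : ∀ x → y x ≤ fromℕ 2
      y≤2 x = ≤-trans (y≤a+2T x) a+2T≤2

    open State

    -- The potential enters only through these bounds: `H-smooth` controls a step, `h-below` and
    -- `h-above` place `h` relative to the diagonal on the two sides of 1, and `fenchel` with `E-B`
    -- caps the gain.
    module NearMaximizer
      (h H : ℝ → ℝ) (M σ : ℝ) (f B : X → ℝ)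
      (H-cong : ∀ {y y′} → y ≈ y′ → H y ≈ H y′)
      (0≤M : 0# ≤ M) (0<σ : 0# < σ) (18σ≤1 : fromℕ 18 * σ ≤ 1#)
      (H-smooth : ∀ {y y′} → 0# ≤ y → y ≤ fromℕ 2 → 0# ≤ y′ → y′ ≤ fromℕ 2 →
                  H y′ - H y ≤ (y′ - y) * h y + M * ((y′ - y) * (y′ - y)))
      (h-below : ∀ {y} → 0# ≤ y → y ≤ 1# → h y ≤ y)
      (h-above : ∀ {y} → 1# ≤ y → y ≤ fromℕ 2 → y ≤ h y)
      (E-f : E f ≈ 1#)
      (fenchel : ∀ x {y} → 0# ≤ y → y ≤ fromℕ 2 → f x * (y - 1#) - (H y - H 1#) ≤ B x)
      (E-B : E B ≤ fromℕ 6 * σ)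
      where

      gain : State → ℝ
      gain s = E λ x → f x * y s x - H (y s x)

      J : State → ℝ
      J s = gain s - fromℕ 15 * σ * T s

      initial : State
      initial = record { a = 1# ; w = λ _ → 0# ; T = 0# ; cone = origin ; 0≤a = 0≤1
                     ; a+2T≤2 = ≤-by 0≤1 (solve 0 (# 1 :+ (# 0 :+ # 0) :+ # 1 := # 2) refl) }

      -- Bounds the gain before the penalty is subtracted. A near-maximiser must not lose much to
      -- `initial`, where `T = 0`, so this cap limits the penalty it can afford.
      J-upper : ∀ s → gain s ≤ J initial + fromℕ 6 * σ
      J-upper s = ≤-trans (E-mono-≤ pointwise) (≤-respˡ-≈ (sym (E-+ _ B)) (+-mono-≤
        (≤-reflexive (solve 2 (λ g σ → g := g :- # 15 :* σ :* # 0) refl (gain initial) σ)) E-B))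
        where
        pointwise : ∀ x → f x * y s x - H (y s x) ≤ f x * (1# + 0#) - H (1# + 0#) + B x
        pointwise x = ≤-by (0≤y-x (fenchel x (0≤y s x) (y≤2 s x))) (trans
          (solve 5 (λ f y H K B → f :* y :- H :+ (B :- (f :* (y :- # 1) :- (H :- K))) := f :* (# 1 :+ # 0) :- K :+ B) refl
            (f x) (y s x) (H (y s x)) (H 1#) (B x))
          (+-congʳ (+-congˡ (-‿cong (H-cong (sym (+-identityʳ 1#)))))))

      0≤σT : ∀ s → 0# ≤ fromℕ 15 * σ * T s
      0≤σT s = *-nonNeg (*-nonNeg (0≤fromℕ 15) (<⇒≤ 0<σ)) (cone-weight-nonNeg (cone s))

      Value : Pred ℝ 0ℓ
      Value v = ∃[ s ] v ≈ J s

      maximum : ∃ (IsLeastUpperBound Value)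
      maximum = complete Value (J initial , initial , refl) (J initial + fromℕ 6 * σ , λ { v (s , e) → ≤-respˡ-≈ (sym e)
        (≤-trans (≤-by (0≤σT s) (solve 2 (λ g t → g :- t :+ t := g) refl (gain s) _)) (J-upper s)) })

      -- The summand `4 M` pays for the second-order loss, directions being bounded by 2; the
      -- summand 11 makes `δ` small against `σ` and leaves `11 δ²` for the optimality gap `ρ`.
      k δ : ℝ
      k = fromℕ 11 + fromℕ 4 * M
      δ = k ⁻¹ * σ

      0<k : 0# < k
      0<k = +-pos (0<fromℕ 11) (*-nonNeg (0≤fromℕ 4) 0≤M)

      0<δ : 0# < δ
      0<δ = *-pos (⁻¹-pos 0<k) 0<σ

      0≤δ = <⇒≤ 0<δ

      σ≈kδ : σ ≈ k * δ
      σ≈kδ = begin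
        σ                   ≈⟨ *-identityˡ σ ⟨
        1# * σ              ≈⟨ *-congʳ (*-inverseʳ (>0⇒≉0 0<k)) ⟨
        k * k ⁻¹ * σ        ≈⟨ *-assoc k (k ⁻¹) σ ⟩
        k * δ               ∎

      10δ≤σ : fromℕ 10 * δ ≤ σ
      10δ≤σ = ≤-respʳ-≈ (sym σ≈kδ) (≤-by (+-nonNeg 0≤δ (*-nonNeg (*-nonNeg (0≤fromℕ 4) 0≤M) 0≤δ))
        (solve 2 (λ M d → # 10 :* d :+ (d :+ # 4 :* M :* d) := (# 11 :+ # 4 :* M) :* d) refl M δ))

      δ≤1 : δ ≤ 1#
      δ≤1 = ≤-trans (≤-trans (≤-by (*-nonNeg (0≤fromℕ 9) 0≤δ) (solve 1 (λ d → d :+ # 9 :* d := # 10 :* d) refl δ)) 10δ≤σ)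
        (≤-trans (≤-by (*-nonNeg (0≤fromℕ 17) (<⇒≤ 0<σ)) (solve 1 (λ s → s :+ # 17 :* s := # 18 :* s) refl σ)) 18σ≤1)

      ρ : ℝ
      ρ = δ * (fromℕ 11 * δ)

      -- The choice of δ makes the second-order loss 4Mδ² plus the optimality gap ρ equal to δσ.
      ρ+loss≈δσ : ρ + fromℕ 4 * M * (δ * δ) ≈ δ * σ
      ρ+loss≈δσ = trans (solve 2 (λ M d → d :* (# 11 :* d) :+ # 4 :* M :* (d :* d) := d :* ((# 11 :+ # 4 :* M) :* d)) refl M δ)
                        (*-congˡ (sym σ≈kδ))

      near-maximizer : ∃[ s ] (∀ s′ → J s′ ≤ J s + ρ)
      near-maximizer =
        let v , (s , v≈Js) , p = approach-lub (proj₂ maximum) (*-pos 0<δ (*-pos (0<fromℕ 11) 0<δ))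
        in s , λ s′ → ≤-trans (proj₁ (proj₂ maximum) (J s′) (s′ , refl))
          (≤-by (0≤y-x (<⇒≤ p)) (trans
            (solve 3 (λ m r v → m :+ (v :- (m :- r)) := v :+ r) refl (proj₁ maximum) ρ v)
            (+-congʳ v≈Js)))

      module FirstOrderConditions (s : State) (J≤Js+ρ : ∀ s′ → J s′ ≤ J s + ρ) where

        G : X → ℝ
        G x = h (y s x)

        -- Comparing `J s′` with `J s` bounds the directional derivative of the gain: `15 σ τ` is
        -- the price of the added weight, and the final `σ` is `(ρ + loss) / δ`. The bound is
        -- one-sided, since only steps that end in a `State` are allowed.
        variation : ∀ s′ (v : X → ℝ) τ → (∀ x → y s′ x ≈ y s x + δ * v x) → (∀ x → v x * v x ≤ fromℕ 4) → T s′ ≈ T s + δ * τ →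
                    E (λ x → (f x - G x) * v x) ≤ fromℕ 15 * σ * τ + σ
        variation s′ v τ y′≈ v²≤4 T′≈ = *-cancelˡ-≤ δ 0<δ (≤-by (+-nonNeg (0≤y-x gain-increase) (0≤y-x (J≤Js+ρ s′))) (begin
          δ * A + (gain s′ - (gain s + (δ * A - loss)) + (gain s - c * T s + ρ - (gain s′ - c * T s′)))
            ≈⟨ solve 7 (λ x g g′ l r t t′ → x :+ (g′ :- (g :+ (x :- l)) :+ (g :- t :+ r :- (g′ :- t′))) := r :+ l :+ (t′ :- t)) refl
                 (δ * A) (gain s) (gain s′) loss ρ (c * T s) (c * T s′) ⟩
          ρ + loss + (c * T s′ - c * T s)
            ≈⟨ +-cong ρ+loss≈δσ (+-congʳ (*-congˡ T′≈)) ⟩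
          δ * σ + (c * (T s + δ * τ) - c * T s)
            ≈⟨ solve 5 (λ d s c T t → d :* s :+ (c :* (T :+ d :* t) :- c :* T) := d :* (c :* t :+ s)) refl
                 δ σ c (T s) τ ⟩
          δ * (c * τ + σ) ∎))
          where
          A = E λ x → (f x - G x) * v x
          c = fromℕ 15 * σ
          loss = fromℕ 4 * M * (δ * δ)
          pointwise : ∀ x → f x * y s x - H (y s x) + (δ * ((f x - G x) * v x) - loss) ≤ f x * y s′ x - H (y s′ x)
          pointwise x = ≤-by (+-nonNeg (0≤y-x smooth) (*-nonNeg (*-nonNeg 0≤M (0≤x² δ)) (0≤y-x (v²≤4 x)))) (trans
              (solve 9 (λ f y H G v M d H′ l →
                   f :* y :- H :+ (d :* ((f :- G) :* v) :- # 4 :* M :* (d :* d))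
                   :+ ((d :* v) :* G :+ M :* ((d :* v) :* (d :* v)) :- (H′ :- H) :+ M :* (d :* d) :* (# 4 :- v :* v))
                   := f :* (y :+ d :* v) :- H′) refl
                (f x) (y s x) (H (y s x)) (G x) (v x) M δ (H (y s′ x)) loss)
              (+-congʳ (*-congˡ (sym (y′≈ x)))))
            where
            y′-y : y s′ x - y s x ≈ δ * v x
            y′-y = trans (+-congʳ (y′≈ x)) (solve 2 (λ y z → y :+ z :- y := z) refl (y s x) (δ * v x))
            smooth : H (y s′ x) - H (y s x) ≤ δ * v x * G x + M * (δ * v x * (δ * v x))
            smooth = ≤-respʳ-≈ (+-cong (*-congʳ y′-y) (*-congˡ (*-cong y′-y y′-y)))
              (H-smooth (0≤y s x) (y≤2 s x) (0≤y s′ x) (y≤2 s′ x))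
          gain-increase : gain s + (δ * A - loss) ≤ gain s′
          gain-increase = ≤-respˡ-≈ (begin
            E (λ x → f x * y s x - H (y s x) + (δ * ((f x - G x) * v x) - loss))
              ≈⟨ E-+ _ _ ⟩
            gain s + E (λ x → δ * ((f x - G x) * v x) - loss)
              ≈⟨ +-congˡ (trans (E-sub _ _) (+-cong (E-scale δ _) (-‿cong (E-const loss)))) ⟩
            gain s + (δ * A - loss) ∎) (E-mono-≤ pointwise)

        -- Comparison with `initial`: the penalty is at most the extra gain `6 σ` plus `ρ`, and
        -- `ρ ≤ δ σ`.
        15T≤6+δ : fromℕ 15 * T s ≤ fromℕ 6 + δ
        15T≤6+δ = *-cancelˡ-≤ σ 0<σ (≤-by
          (+-nonNeg (+-nonNeg (0≤y-x (J-upper s)) (0≤y-x (J≤Js+ρ initial))) (*-nonNeg (*-nonNeg (0≤fromℕ 4) 0≤M) (0≤x² δ)))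
          (begin
            σ * (fromℕ 15 * T s) + (J initial + fromℕ 6 * σ - gain s + (gain s - fromℕ 15 * σ * T s + ρ - J initial) + loss)
              ≈⟨ solve 6 (λ s T j g r l → s :* (# 15 :* T) :+ (j :+ # 6 :* s :- g :+ (g :- # 15 :* s :* T :+ r :- j) :+ l)
                                        := # 6 :* s :+ (r :+ l)) refl σ (T s) (J initial) (gain s) ρ loss ⟩
            fromℕ 6 * σ + (ρ + loss)        ≈⟨ +-congˡ ρ+loss≈δσ ⟩
            fromℕ 6 * σ + δ * σ             ≈⟨ solve 2 (λ s d → # 6 :* s :+ d :* s := s :* (# 6 :+ d)) refl σ δ ⟩
            σ * (fromℕ 6 + δ)               ∎))
          where loss = fromℕ 4 * M * (δ * δ)

        E-f-G : E (λ x → f x - G x) ≈ 1# - E G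
        E-f-G = trans (E-sub f G) (+-congʳ E-f)

        -- If `δ ≤ a`, the constant `a` can be lowered by `δ` at no cost in weight. Otherwise `y`
        -- stays below 1, where `h y ≤ y`, and the bound holds without any variation.
        E-G≤1+σ : E G ≤ 1# + σ
        E-G≤1+σ = [ small , large ]′ (total (a s) δ)
          where
          small : a s ≤ δ → E G ≤ 1# + σ
          small a≤δ = ≤-trans (≤-respʳ-≈ (E-const 1#) (E-mono-≤ G≤1)) (≤-by (<⇒≤ 0<σ) refl)
              where
              -- In essence `δ + 2 (6 + δ)/15 ≤ 1` for small `δ`; the remainder given to `≤-by` is a
              -- combination of known inequalities with denominators cleared by 15.
              y≤1 : ∀ x → y s x ≤ 1#
              y≤1 x = ≤-trans (y≤a+2T s x) (*-cancelˡ-≤ (fromℕ 15) (0<fromℕ 15) (≤-by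
                (+-nonNeg (+-nonNeg (*-nonNeg (0≤fromℕ 15) (0≤y-x a≤δ)) (*-nonNeg (0≤fromℕ 2) (0≤y-x 15T≤6+δ)))
                  (+-nonNeg (*-nonNeg (0≤fromℕ 2) (0≤y-x 10δ≤σ)) (+-nonNeg (0≤y-x 18σ≤1) (+-nonNeg (*-nonNeg (0≤fromℕ 16) (<⇒≤ 0<σ))
                    (+-nonNeg (*-nonNeg (0≤fromℕ 2) (0≤y-x δ≤1)) (*-nonNeg (0≤fromℕ 5) 0≤δ))))))
                (solve 4 (λ a T s d → # 15 :* (a :+ (T :+ T)) :+
                    (# 15 :* (d :- a) :+ # 2 :* (# 6 :+ d :- # 15 :* T)
                      :+ (# 2 :* (s :- # 10 :* d) :+ (# 1 :- # 18 :* s :+ (# 16 :* s :+ (# 2 :* (# 1 :- d) :+ # 5 :* d)))))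
                    := # 15 :* # 1) refl (a s) (T s) σ δ)))
              G≤1 : ∀ x → G x ≤ 1#
              G≤1 x = ≤-trans (h-below (0≤y s x) (y≤1 x)) (y≤1 x)
          large : δ ≤ a s → E G ≤ 1# + σ
          large δ≤a = ≤-by (0≤y-x (≤-respˡ-≈ reduce (variation down (λ _ → - 1#) 0#
                  (λ x → solve 3 (λ a d w → a :- d :+ w := a :+ w :+ d :* (:- # 1)) refl (a s) δ (w s x))
                  (λ x → ≤-by (0≤fromℕ 3) (solve 0 ((:- # 1) :* (:- # 1) :+ # 3 := # 4) refl))
                  (solve 2 (λ T d → T := T :+ d :* # 0) refl (T s) δ))))
                (solve 2 (λ g s → g :+ (# 15 :* s :* # 0 :+ s :- (:- # 1) :* (# 1 :- g)) := # 1 :+ s) refl (E G) σ)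
              where
              down : State
              down = record
                { a = a s - δ ; w = w s ; T = T s ; cone = cone s ; 0≤a = 0≤y-x δ≤a
                ; a+2T≤2 = ≤-trans (≤-by 0≤δ (solve 3 (λ a d t → a :- d :+ t :+ d := a :+ t) refl (a s) δ (T s + T s))) (a+2T≤2 s) }
              reduce : E (λ x → (f x - G x) * - 1#) ≈ - 1# * (1# - E G)
              reduce = trans (E-cong λ x → *-comm _ _) (trans (E-scale (- 1#) _) (*-congˡ E-f-G))

        -- If `a ≥ 1`, then `a ≤ y ≤ h y` at every point, and averaging compares `a` with `E G`.
        a≤1+σ : a s ≤ 1# + σ
        a≤1+σ = [ (λ a≤1 → ≤-trans a≤1 (≤-by (<⇒≤ 0<σ) refl)) , large ]′ (total (a s) 1#)
          where
          large : 1# ≤ a s → a s ≤ 1# + σ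
          large 1≤a = ≤-trans (≤-respˡ-≈ (E-const (a s)) (E-mono-≤ λ x →
                           ≤-trans (a≤y s x) (h-above (≤-trans 1≤a (a≤y s x)) (y≤2 s x)))) E-G≤1+σ

        -- The upper constraint is inactive: `(1 + σ) + 2 (6 + δ)/15 + 2 δ ≤ 2`. The slack admits a
        -- step of `δ` in `T`, and a fortiori one in `a`.
        room : a s + (T s + δ + (T s + δ)) ≤ fromℕ 2
        room = *-cancelˡ-≤ (fromℕ 15) (0<fromℕ 15) (≤-by
          (+-nonNeg (+-nonNeg (*-nonNeg (0≤fromℕ 15) (0≤y-x a≤1+σ)) (*-nonNeg (0≤fromℕ 2) (0≤y-x 15T≤6+δ)))
            (+-nonNeg (0≤y-x 18σ≤1) (+-nonNeg (*-nonNeg (0≤fromℕ 3) (0≤y-x 10δ≤σ)) (*-nonNeg (0≤fromℕ 2) (0≤y-x δ≤1)))))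
          (solve 4 (λ a T s d → # 15 :* (a :+ (T :+ d :+ (T :+ d))) :+
              (# 15 :* (# 1 :+ s :- a) :+ # 2 :* (# 6 :+ d :- # 15 :* T)
                :+ (# 1 :- # 18 :* s :+ (# 3 :* (s :- # 10 :* d) :+ # 2 :* (# 1 :- d))))
              := # 15 :* # 2) refl (a s) (T s) σ δ))

        1-σ≤E-G : 1# - σ ≤ E G
        1-σ≤E-G = ≤-by (0≤y-x (≤-respˡ-≈ (trans (E-cong λ x → *-identityʳ _) E-f-G) (variation up (λ _ → 1#) 0#
              (λ x → solve 3 (λ a d w → a :+ d :+ w := a :+ w :+ d :* # 1) refl (a s) δ (w s x))
              (λ x → ≤-by (0≤fromℕ 3) (solve 0 (# 1 :* # 1 :+ # 3 := # 4) refl))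
              (solve 2 (λ T d → T := T :+ d :* # 0) refl (T s) δ))))
            (solve 2 (λ g s → # 1 :- s :+ (# 15 :* s :* # 0 :+ s :- (# 1 :- g)) := g) refl (E G) σ)
          where
          up : State
          up = record
            { a = a s + δ ; w = w s ; T = T s ; cone = cone s ; 0≤a = +-nonNeg (0≤a s) 0≤δ
            ; a+2T≤2 = ≤-trans (≤-by 0≤δ (solve 3 (λ a d T → a :+ d :+ (T :+ T) :+ d := a :+ (T :+ d :+ (T :+ d))) refl (a s) δ (T s))) room }

        -- The step along `1 + e φ` has weight 1 and gives `16 σ`; its constant part contributes
        -- `1 - E G ≥ - σ`, which costs one more `σ`.
        correlation≤17σ : ∀ {φ e} → φ ∈ F → IsSign e → E (λ x → (f x - G x) * (e * φ x)) ≤ fromℕ 17 * σ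
        correlation≤17σ {φ} {e} φ∈F sgn = ≤-by
          (+-nonNeg (0≤y-x (≤-respˡ-≈ split (variation forward (λ x → 1# + e * φ x) 1#
              (λ x → solve 4 (λ a w d v → a :+ (w :+ d :* v) := a :+ w :+ d :* v) refl (a s) (w s x) δ (1# + e * φ x))
              (λ x → ≤-respʳ-≈ (solve 0 ((# 1 :+ # 1) :* (# 1 :+ # 1) := # 4) refl)
                (*-mono-≤ (0≤1+eφ sgn φ∈F x) (+-nonNeg 0≤1 0≤1) (1+eφ≤2 sgn φ∈F x) (1+eφ≤2 sgn φ∈F x)))
              (+-congˡ (sym (*-identityʳ δ))))))
            (0≤y-x E-G≤1+σ))
          (solve 3 (λ c g s → c :+ (# 15 :* s :* # 1 :+ s :- (# 1 :- g :+ c) :+ (# 1 :+ s :- g)) := # 17 :* s) refl C (E G) σ)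
          where
          C = E λ x → (f x - G x) * (e * φ x)
          forward : State
          forward = record
            { a = a s ; w = λ x → w s x + δ * (1# + e * φ x) ; T = T s + δ ; cone = extend φ∈F sgn 0≤δ (cone s)
            ; 0≤a = 0≤a s ; a+2T≤2 = room }
          split : E (λ x → (f x - G x) * (1# + e * φ x)) ≈ 1# - E G + C
          split = trans (E-cong λ x → solve 2 (λ d v → d :* (# 1 :+ v) := d :+ d :* v) refl (f x - G x) (e * φ x))
            (trans (E-+ _ _) (+-congʳ E-f-G))

  -- The polynomial potential

  module Potential (n : ℕ) where

    -- On [0,2]; the Lipschitz bound is multiplied through by y′ - y to avoid absolute values.
    record Tame (g : ℝ → ℝ) : Set where
      field
        bound lipschitz : ℝ
        0≤bound     : 0# ≤ bound
        0≤lipschitz : 0# ≤ lipschitz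
        nonNeg      : ∀ {y} → 0# ≤ y → y ≤ fromℕ 2 → 0# ≤ g y
        bounded     : ∀ {y} → 0# ≤ y → y ≤ fromℕ 2 → g y ≤ bound
        slope       : ∀ {y y′} → 0# ≤ y → y ≤ fromℕ 2 → 0# ≤ y′ → y′ ≤ fromℕ 2 →
                      (g y′ - g y) * (y′ - y) ≤ lipschitz * ((y′ - y) * (y′ - y))

    tame-1 : Tame (λ _ → 1#)
    tame-1 = record
      { bound = 1# ; lipschitz = 0# ; 0≤bound = 0≤1 ; 0≤lipschitz = ≤-refl
      ; nonNeg = λ _ _ → 0≤1 ; bounded = λ _ _ → ≤-refl
      ; slope = λ {y} {y′} _ _ _ _ → ≤-reflexive
          (solve 2 (λ y y′ → (# 1 :- # 1) :* (y′ :- y) := # 0 :* ((y′ :- y) :* (y′ :- y))) refl y y′) }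

    tame-id : Tame (λ y → y)
    tame-id = record
      { bound = fromℕ 2 ; lipschitz = 1# ; 0≤bound = 0≤fromℕ 2 ; 0≤lipschitz = 0≤1
      ; nonNeg = λ p _ → p ; bounded = λ _ q → q
      ; slope = λ _ _ _ _ → ≤-reflexive (sym (*-identityˡ _)) }

    tame-+const : ∀ {g k} → 0# ≤ k → Tame g → Tame (λ y → k + g y)
    tame-+const {g} {k} 0≤k t = record
      { bound = k + bound ; lipschitz = lipschitz ; 0≤bound = +-nonNeg 0≤k 0≤bound ; 0≤lipschitz = 0≤lipschitz
      ; nonNeg = λ p q → +-nonNeg 0≤k (nonNeg p q) ; bounded = λ p q → +-mono-≤ ≤-refl (bounded p q)
      ; slope = λ p q p′ q′ → ≤-respˡ-≈ (*-congʳ (solve 3 (λ k x y → x :- y := k :+ x :- (k :+ y)) refl k _ _)) (slope p q p′ q′) }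
      where open Tame t

    -- Product rule `g′h′ - gh = g′ (h′ - h) + h (g′ - g)`. As `slope` bounds from above only, the
    -- multipliers `g′` and `h` have to be non-negative.
    tame-* : ∀ {g h} → Tame g → Tame h → Tame (λ y → g y * h y)
    tame-* {g} {h} s t = record
      { bound = S.bound * T.bound
      ; lipschitz = S.bound * T.lipschitz + T.bound * S.lipschitz
      ; 0≤bound = *-nonNeg S.0≤bound T.0≤bound
      ; 0≤lipschitz = +-nonNeg (*-nonNeg S.0≤bound T.0≤lipschitz) (*-nonNeg T.0≤bound S.0≤lipschitz)
      ; nonNeg = λ p q → *-nonNeg (S.nonNeg p q) (T.nonNeg p q)
      ; bounded = λ p q → *-mono-≤ (S.nonNeg p q) T.0≤bound (S.bounded p q) (T.bounded p q)
      ; slope = λ {y} {y′} p q p′ q′ → ≤-by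
          (+-nonNeg
            (+-nonNeg (*-nonNeg (S.nonNeg p′ q′) (0≤y-x (T.slope p q p′ q′)))
                      (*-nonNeg (0≤y-x (S.bounded p′ q′)) (*-nonNeg T.0≤lipschitz (0≤x² (y′ - y)))))
            (+-nonNeg (*-nonNeg (T.nonNeg p q) (0≤y-x (S.slope p q p′ q′)))
                      (*-nonNeg (0≤y-x (T.bounded p q)) (*-nonNeg S.0≤lipschitz (0≤x² (y′ - y))))))
          (solve 9 (λ g g′ h h′ d A B L K →
              (g′ :* h′ :- g :* h) :* d :+
                (g′ :* (K :* (d :* d) :- (h′ :- h) :* d) :+ (A :- g′) :* (K :* (d :* d))
                  :+ (h :* (L :* (d :* d) :- (g′ :- g) :* d) :+ (B :- h) :* (L :* (d :* d))))
              := (A :* K :+ B :* L) :* (d :* d)) refl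
            (g y) (g y′) (h y) (h y′) (y′ - y) S.bound T.bound S.lipschitz T.lipschitz) }
      where
      module S = Tame s
      module T = Tame t

    tame-^ : ∀ {g} k → Tame g → Tame (λ y → g y ^ k)
    tame-^ zero    t = tame-1
    tame-^ (suc k) t = tame-* t (tame-^ k t)

    Q : ℝ → ℝ
    Q y = fromℕ 3 + y * y

    m c scale : ℝ
    m     = fromℕ (suc n)
    c     = fromℕ 2 * m
    scale = c * fromℕ 4 ^ n

    0<c : 0# < c
    0<c = *-pos (0<fromℕ 2) (0<fromℕ-suc n)

    0<scale : 0# < scale
    0<scale = *-pos 0<c (^-pos n (0<fromℕ 4))

    r : ℝ
    r = scale ⁻¹

    0≤r : 0# ≤ r
    0≤r = <⇒≤ (⁻¹-pos 0<scale)

    -- H is a primitive of h, and r normalises h 1 to 1.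
    h H : ℝ → ℝ
    h y = r * (c * (y * Q y ^ n))
    H y = r * Q y ^ suc n

    0≤Q : ∀ y → 0# ≤ Q y
    0≤Q y = +-nonNeg (0≤fromℕ 3) (0≤x² y)

    h-nonNeg : ∀ {y} → 0# ≤ y → 0# ≤ h y
    h-nonNeg {y} p = *-nonNeg 0≤r (*-nonNeg (<⇒≤ 0<c) (*-nonNeg p (^-nonNeg n (0≤Q y))))

    H-cong : ∀ {y y′} → y ≈ y′ → H y ≈ H y′
    H-cong p = *-congˡ (^-congˡ (suc n) (+-congˡ (*-cong p p)))

    tame : Tame (λ y → y * Q y ^ n)
    tame = tame-* tame-id (tame-^ n (tame-+const (0≤fromℕ 3) (tame-* tame-id tame-id)))

    M : ℝ
    M = r * (c * Tame.lipschitz tame)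

    0≤M : 0# ≤ M
    0≤M = *-nonNeg 0≤r (*-nonNeg (<⇒≤ 0<c) (Tame.0≤lipschitz tame))

    -- Bernoulli at the end point `Q y′` gives `H y′ - H y ≤ r m (Q y′ - Q y) Q y′ ^ n`, and
    -- `Q y′ - Q y = 2 y′ (y′ - y) - (y′ - y)²`. Dropping the square leaves `(y′ - y) * h y′`;
    -- replacing `h y′` by `h y` costs the Lipschitz term.
    H-smooth : ∀ {y y′} → 0# ≤ y → y ≤ fromℕ 2 → 0# ≤ y′ → y′ ≤ fromℕ 2 →
               H y′ - H y ≤ (y′ - y) * h y + M * ((y′ - y) * (y′ - y))
    H-smooth {y} {y′} p q p′ q′ = ≤-by
      (*-nonNeg 0≤r (+-nonNeg
        (+-nonNeg (0≤y-x (bernoulli n (0≤Q y′) (0≤Q y)))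
                  (*-nonNeg (*-nonNeg (0≤fromℕ (suc n)) (^-nonNeg n (0≤Q y′))) (0≤x² (y′ - y))))
        (*-nonNeg (<⇒≤ 0<c) (0≤y-x (Tame.slope tame p q p′ q′)))))
      (solve 8 (λ y y′ r m A P′ P L →
          r :* (Q′ y′ :* P′) :- r :* A
            :+ r :* (A :- (Q′ y′ :* P′ :+ m :* (Q′ y :- Q′ y′) :* P′) :+ m :* P′ :* ((y′ :- y) :* (y′ :- y))
              :+ # 2 :* m :* (L :* ((y′ :- y) :* (y′ :- y)) :- (y′ :* P′ :- y :* P) :* (y′ :- y)))
          := (y′ :- y) :* (r :* (# 2 :* m :* (y :* P))) :+ r :* (# 2 :* m :* L) :* ((y′ :- y) :* (y′ :- y)))
        refl y y′ r m (Q y ^ suc n) (Q y′ ^ n) (Q y ^ n) (Tame.lipschitz tame))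
      where Q′ = λ y → # 3 :+ y :* y

    r*scale : ∀ x → r * (c * (x * fromℕ 4 ^ n)) ≈ x
    r*scale x = begin
      r * (c * (x * fromℕ 4 ^ n))     ≈⟨ solve 4 (λ r c x k → r :* (c :* (x :* k)) := c :* k :* r :* x) refl
           r c x (fromℕ 4 ^ n) ⟩
      scale * r * x                   ≈⟨ *-congʳ (*-inverseʳ (>0⇒≉0 0<scale)) ⟩
      1# * x                          ≈⟨ *-identityˡ x ⟩
      x                               ∎

    h-below : ∀ {y} → 0# ≤ y → y ≤ 1# → h y ≤ y
    h-below {y} 0≤y y≤1 = ≤-respʳ-≈ (r*scale y) (*-monoʳ-≤ r 0≤r (*-monoʳ-≤ c (<⇒≤ 0<c) (*-monoʳ-≤ y 0≤y
      (^-monoˡ-≤ n (0≤Q y) (≤-by (*-nonNeg (0≤y-x y≤1) (+-nonNeg 0≤1 0≤y))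
        (solve 1 (λ y → # 3 :+ y :* y :+ (# 1 :- y) :* (# 1 :+ y) := # 4) refl y))))))

    h-above : ∀ {y} → 1# ≤ y → y ≤ fromℕ 2 → y ≤ h y
    h-above {y} 1≤y _ = ≤-respˡ-≈ (r*scale y) (*-monoʳ-≤ r 0≤r (*-monoʳ-≤ c (<⇒≤ 0<c) (*-monoʳ-≤ y 0≤y
      (^-monoˡ-≤ n (0≤fromℕ 4) (≤-by (*-nonNeg (0≤y-x 1≤y) (+-nonNeg 0≤1 0≤y))
        (solve 1 (λ y → # 4 :+ (y :- # 1) :* (# 1 :+ y) := # 3 :+ y :* y) refl y))))))
      where 0≤y = ≤-trans 0≤1 1≤y

    κ : ℝ
    κ = r * fromℕ 4 ^ suc n

    0≤κ : 0# ≤ κ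
    0≤κ = *-nonNeg 0≤r (^-nonNeg (suc n) (0≤fromℕ 4))

    m*κ≈2 : m * κ ≈ fromℕ 2
    m*κ≈2 = begin
      m * (r * (fromℕ 4 * fromℕ 4 ^ n))
        ≈⟨ solve 3 (λ m r k → m :* (r :* (# 4 :* k)) := r :* (# 2 :* m :* (# 2 :* k))) refl m r (fromℕ 4 ^ n) ⟩
      r * (c * (fromℕ 2 * fromℕ 4 ^ n))
        ≈⟨ r*scale (fromℕ 2) ⟩
      fromℕ 2 ∎

    fenchel : ∀ {x} → 0# ≤ x → ∀ {y} → 0# ≤ y → y ≤ fromℕ 2 →
              x * (y - 1#) - (H y - H 1#) ≤ κ * (x * log x - x + 1#)
    fenchel {x} 0≤x {y} 0≤y y≤2 = ≤-by
      (*-nonNeg 0≤κ (+-nonNeg (0≤y-x (fenchel-young 0≤x s)) (0≤y-x (exp≤quadratic^ 6v≤1 (suc n)))))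
      (begin
        x * (y - 1#) - (H y - H 1#) + κ * (x * log x - (x + x * s - exp s) + (q ^ suc n - exp s))
          ≈⟨ +-congʳ (+-cong (sym x-term) (-‿cong (+-cong H-y (-‿cong H-1)))) ⟩
        κ * (x * s) - (κ * q ^ suc n - κ) + κ * (x * log x - (x + x * s - exp s) + (q ^ suc n - exp s))
          ≈⟨ solve 6 (λ k x s e p l → k :* (x :* s) :- (k :* p :- k) :+ k :* (x :* l :- (x :+ x :* s :- e) :+ (p :- e))
                                    := k :* (x :* l :- x :+ # 1)) refl κ x s (exp s) (q ^ suc n) (log x) ⟩
        κ * (x * log x - x + 1#) ∎)
      where
      v = (y - 1#) * fromℕ 6 ⁻¹
      s = fromℕ (suc n ℕ.* 3) * v
      q = 1# + fromℕ 3 * v + fromℕ 9 * (v * v)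
      6v≈y-1 : fromℕ 6 * v ≈ y - 1#
      6v≈y-1 = begin
        fromℕ 6 * ((y - 1#) * fromℕ 6 ⁻¹)       ≈⟨ solve 3 (λ k z i → k :* (z :* i) := k :* i :* z) refl
             (fromℕ 6) (y - 1#) (fromℕ 6 ⁻¹) ⟩
        fromℕ 6 * fromℕ 6 ⁻¹ * (y - 1#)         ≈⟨ *-congʳ (*-inverseʳ (>0⇒≉0 (0<fromℕ 6))) ⟩
        1# * (y - 1#)                           ≈⟨ *-identityˡ _ ⟩
        y - 1#                                  ∎
      6v≤1 : fromℕ 6 * v ≤ 1#
      6v≤1 = ≤-respˡ-≈ (sym 6v≈y-1) (≤-by (0≤y-x y≤2) (solve 1 (λ y → y :- # 1 :+ (# 2 :- y) := # 1) refl y))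
      Q≈4q : Q y ≈ fromℕ 4 * q
      Q≈4q = begin
        fromℕ 3 + y * y
          ≈⟨ solve 1 (λ y → # 3 :+ y :* y := # 3 :+ (# 1 :+ (y :- # 1)) :* (# 1 :+ (y :- # 1))) refl y ⟩
        fromℕ 3 + (1# + (y - 1#)) * (1# + (y - 1#))
          ≈⟨ +-congˡ (*-cong (+-congˡ 6v≈y-1) (+-congˡ 6v≈y-1)) ⟨
        fromℕ 3 + (1# + fromℕ 6 * v) * (1# + fromℕ 6 * v)
          ≈⟨ solve 1 (λ v → # 3 :+ (# 1 :+ # 6 :* v) :* (# 1 :+ # 6 :* v) := # 4 :* (# 1 :+ # 3 :* v :+ # 9 :* (v :* v))) refl
               v ⟩
        fromℕ 4 * q ∎
      H-y : H y ≈ κ * q ^ suc n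
      H-y = trans (*-congˡ (trans (^-congˡ (suc n) Q≈4q) (^-distrib-* (fromℕ 4) q (suc n)))) (sym (*-assoc _ _ _))
      H-1 : H 1# ≈ κ
      H-1 = *-congˡ (^-congˡ (suc n) (solve 0 (# 3 :+ # 1 :* # 1 := # 4) refl))
      x-term : κ * (x * s) ≈ x * (y - 1#)
      x-term = begin
        κ * (x * (fromℕ (suc n ℕ.* 3) * v))
          ≈⟨ *-congˡ (*-congˡ (*-congʳ (×1-homo-* (suc n) 3))) ⟩
        κ * (x * (m * fromℕ 3 * v))
          ≈⟨ solve 4 (λ k x m v → k :* (x :* (m :* # 3 :* v)) := m :* k :* (x :* (# 3 :* v))) refl κ x m v ⟩
        m * κ * (x * (fromℕ 3 * v))
          ≈⟨ *-congʳ m*κ≈2 ⟩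
        fromℕ 2 * (x * (fromℕ 3 * v))
          ≈⟨ solve 2 (λ x v → # 2 :* (x :* (# 3 :* v)) := x :* (# 6 :* v)) refl x v ⟩
        x * (fromℕ 6 * v)
          ≈⟨ *-congˡ 6v≈y-1 ⟩
        x * (y - 1#) ∎

  -- Normalisation and the degree bound

  module Approximation (Ω : FiniteProbabilitySpace) (F : Pred (FiniteProbabilitySpace.X Ω → ℝ) 0ℓ)
    (F-inhabited : Satisfiable F) (F-bounded : ∀ {φ} → φ ∈ F → ∀ x → ∣ φ x ∣ ≤ 1#) where
    open FiniteProbabilitySpace Ω
    open Expectation Ω
    open RieszCombinations Ω F F-inhabited

    module Density (f : X → ℝ) (f-density : f ∈ IsDensity Ω) where

      E-f : E f ≈ 1#
      E-f = trans (E-cong λ x → sym (0≤x⇒∣x∣≈x (proj₁ f-density x))) (trans (E≈𝔼 _) (proj₂ f-density))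

      -- Fenchel-Young at `s = 0` reads `f - 1 ≤ f log f`, and `f - 1` has mean zero. The sign
      -- allows `6 Ent f / η` to be rounded up to a natural number.
      Ent-nonNeg : 0# ≤ Ent Ω f
      Ent-nonNeg = ≤-resp (begin
          E (λ x → f x - 1#)         ≈⟨ E-sub f (λ _ → 1#) ⟩
          E f - E (λ _ → 1#)         ≈⟨ +-cong E-f (-‿cong E-1) ⟩
          1# - 1#                    ≈⟨ -‿inverseʳ 1# ⟩
          0#                         ∎)
        (E≈𝔼 _)
        (E-mono-≤ λ x → ≤-respˡ-≈
          (trans (+-congˡ (-‿cong exp-0)) (solve 1 (λ f → f :+ f :* # 0 :- # 1 := f :- # 1) refl (f x)))
          (fenchel-young (proj₁ f-density x) 0#))

      module Construction (η : ℝ) (0<η : 0# < η) (η≤1 : η ≤ 1#)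
        (n : ℕ) (n-large : fromℕ 6 * (Ent Ω f * η ⁻¹) ≤ fromℕ n) where
        open Potential n

        σ : ℝ
        σ = fromℕ 18 ⁻¹ * η

        0<σ : 0# < σ
        0<σ = *-pos (⁻¹-pos (0<fromℕ 18)) 0<η

        18σ≈η : fromℕ 18 * σ ≈ η
        18σ≈η = trans (sym (*-assoc _ _ _)) (trans (*-congʳ (*-inverseʳ (>0⇒≉0 (0<fromℕ 18)))) (*-identityˡ η))

        B : X → ℝ
        B x = κ * (f x * log (f x) - f x + 1#)

        E-B≈κEnt : E B ≈ κ * Ent Ω f
        E-B≈κEnt = begin
          E B                                                 ≈⟨ E-scale κ _ ⟩
          κ * E (λ x → f x * log (f x) - f x + 1#)            ≈⟨ *-congˡ (E-+ _ _) ⟩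
          κ * (E (λ x → f x * log (f x) - f x) + E (λ _ → 1#)) ≈⟨ *-congˡ (+-cong (trans (E-sub _ f) (+-congʳ (E≈𝔼 _))) E-1) ⟩
          κ * (Ent Ω f - E f + 1#)                            ≈⟨ *-congˡ (+-congʳ (+-congˡ (-‿cong E-f))) ⟩
          κ * (Ent Ω f - 1# + 1#)                             ≈⟨ solve 2 (λ k e → k :* (e :- # 1 :+ # 1) := k :* e) refl
               κ (Ent Ω f) ⟩
          κ * Ent Ω f                                         ∎

        6Ent≤mη : fromℕ 6 * Ent Ω f ≤ m * η
        6Ent≤mη = ≤-respˡ-≈ (begin
            η * (fromℕ 6 * (Ent Ω f * η ⁻¹))     ≈⟨ solve 3 (λ h e i → h :* (# 6 :* (e :* i)) := h :* i :* (# 6 :* e)) refl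
                 η (Ent Ω f) (η ⁻¹) ⟩
            η * η ⁻¹ * (fromℕ 6 * Ent Ω f)       ≈⟨ *-congʳ (*-inverseʳ (>0⇒≉0 0<η)) ⟩
            1# * (fromℕ 6 * Ent Ω f)             ≈⟨ *-identityˡ _ ⟩
            fromℕ 6 * Ent Ω f                    ∎)
          (≤-respʳ-≈ (*-comm η m) (*-monoʳ-≤ η (<⇒≤ 0<η) (≤-trans n-large (fromℕ-mono-≤ (ℕ.n≤1+n n)))))

        E-B≤6σ : E B ≤ fromℕ 6 * σ
        E-B≤6σ = ≤-respˡ-≈ (sym E-B≈κEnt) (*-cancelˡ-≤ (fromℕ 3 * m) (*-pos (0<fromℕ 3) (0<fromℕ-suc n)) (≤-resp
          (begin
            fromℕ 6 * Ent Ω f                     ≈⟨ solve 1 (λ e → # 6 :* e := # 3 :* (# 2 :* e)) refl (Ent Ω f) ⟩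
            fromℕ 3 * (fromℕ 2 * Ent Ω f)         ≈⟨ *-congˡ (*-congʳ m*κ≈2) ⟨
            fromℕ 3 * (m * κ * Ent Ω f)           ≈⟨ solve 4 (λ t m k e → t :* (m :* k :* e) := t :* m :* (k :* e)) refl
                 (fromℕ 3) m κ (Ent Ω f) ⟩
            fromℕ 3 * m * (κ * Ent Ω f)           ∎)
          (trans (*-congˡ (sym 18σ≈η)) (solve 2 (λ m s → m :* (# 18 :* s) := # 3 :* m :* (# 6 :* s)) refl m σ))
          6Ent≤mη))

        open DualAscent Ω F F-inhabited F-bounded
        module Ascent = NearMaximizer h H M σ f B H-cong 0≤M 0<σ (≤-respˡ-≈ (sym 18σ≈η) η≤1) H-smooth h-below h-above E-f
                          (λ x → fenchel (proj₁ f-density x)) E-B≤6σ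
        module Optimum = Ascent.FirstOrderConditions (proj₁ Ascent.near-maximizer) (proj₂ Ascent.near-maximizer)
        open Optimum using (G; E-G≤1+σ; 1-σ≤E-G; correlation≤17σ)
        open State (proj₁ Ascent.near-maximizer) using (y; 0≤y; 0≤a; cone)

        Z : ℝ
        Z = E G

        σ<1 : σ < 1#
        σ<1 = <-≤-trans (<-by (*-pos (0<fromℕ 17) 0<σ) (solve 1 (λ s → s :+ # 17 :* s := # 18 :* s) refl σ))
                        (≤-respˡ-≈ (sym 18σ≈η) η≤1)

        0<Z : 0# < Z
        0<Z = <-≤-trans (<⇒0<y-x σ<1) 1-σ≤E-G

        g : X → ℝ
        g x = Z ⁻¹ * G x

        0≤g : ∀ x → 0# ≤ g x
        0≤g x = *-nonNeg (<⇒≤ (⁻¹-pos 0<Z)) (h-nonNeg (0≤y x))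

        E-g : E g ≈ 1#
        E-g = trans (E-scale (Z ⁻¹) G) (trans (*-comm (Z ⁻¹) Z) (*-inverseʳ (>0⇒≉0 0<Z)))

        g-density : g ∈ IsDensity Ω
        g-density = 0≤g , trans (sym (E≈𝔼 _)) (trans (E-cong λ x → 0≤x⇒∣x∣≈x (0≤g x)) E-g)

        Zg≈G : ∀ x → Z * g x ≈ G x
        Zg≈G x = trans (sym (*-assoc Z (Z ⁻¹) (G x))) (trans (*-congʳ (*-inverseʳ (>0⇒≉0 0<Z))) (*-identityˡ (G x)))

        module _ {φ : X → ℝ} (φ∈F : φ ∈ F) where

          E-[f-G]φ-within : E (λ x → (f x - G x) * φ x) within fromℕ 17 * σ
          E-[f-G]φ-within =
              ≤-respˡ-≈ (E-cong λ x → *-congˡ (*-identityˡ (φ x))) (correlation≤17σ φ∈F (inj₂ (inj₂ refl)))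
            , ≤-respˡ-≈ (begin
                E (λ x → (f x - G x) * (- 1# * φ x))
                  ≈⟨ E-cong (λ x → solve 2 (λ d p → d :* ((:- # 1) :* p) := (:- # 1) :* (d :* p)) refl
                       (f x - G x) (φ x)) ⟩
                E (λ x → - 1# * ((f x - G x) * φ x))
                  ≈⟨ E-scale (- 1#) _ ⟩
                - 1# * E (λ x → (f x - G x) * φ x)
                  ≈⟨ solve 1 (λ e → (:- # 1) :* e := :- e) refl _ ⟩
                - E (λ x → (f x - G x) * φ x) ∎) (correlation≤17σ φ∈F (inj₁ refl))

          E-gφ-within : E (λ x → g x * φ x) within 1#
          E-gφ-within =
              ≤-respʳ-≈ E-g (E-mono-≤ λ x → ≤-respʳ-≈ (*-identityʳ (g x))
                (*-monoʳ-≤ (g x) (0≤g x) (≤-trans (x≤∣x∣ (φ x)) (F-bounded φ∈F x))))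
            , ≤-resp (begin
                E (λ x → g x * - φ x)
                  ≈⟨ E-cong (λ x → solve 2 (λ d p → d :* (:- p) := (:- # 1) :* (d :* p)) refl (g x) (φ x)) ⟩
                E (λ x → - 1# * (g x * φ x))
                  ≈⟨ E-scale (- 1#) _ ⟩
                - 1# * E (λ x → g x * φ x)
                  ≈⟨ solve 1 (λ e → (:- # 1) :* e := :- e) refl _ ⟩
                - E (λ x → g x * φ x) ∎) E-g
                (E-mono-≤ λ x → ≤-respʳ-≈ (*-identityʳ (g x))
                  (*-monoʳ-≤ (g x) (0≤g x) (≤-trans (-x≤∣x∣ (φ x)) (F-bounded φ∈F x))))

          Z-1-within : Z - 1# within σ
          Z-1-within = ≤-by (0≤y-x E-G≤1+σ) (solve 2 (λ z s → z :- # 1 :+ (# 1 :+ s :- z) := s) refl Z σ)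
                     , ≤-by (0≤y-x 1-σ≤E-G) (solve 2 (λ z s → :- (z :- # 1) :+ (z :- (# 1 :- s)) := s) refl Z σ)

          -- As `G = Z g`, the difference `f - g` splits into `f - G` and `(Z - 1) g`. The second
          -- part is the price of normalisation: at most `σ`, since `g` is a density and `φ` is
          -- bounded by 1.
          E-decomposition : E (λ x → (f x - G x) * φ x) + E (λ x → g x * φ x) * (Z - 1#) ≈ ⟪ Ω , φ ⟫ (λ x → f x - g x)
          E-decomposition = begin
            E (λ x → (f x - G x) * φ x) + E (λ x → g x * φ x) * (Z - 1#)
              ≈⟨ +-congˡ (trans (*-comm _ _) (sym (E-scale (Z - 1#) _))) ⟩
            E (λ x → (f x - G x) * φ x) + E (λ x → (Z - 1#) * (g x * φ x))
              ≈⟨ E-+ _ _ ⟨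
            E (λ x → (f x - G x) * φ x + (Z - 1#) * (g x * φ x))
              ≈⟨ E-cong (λ x → +-congʳ (*-congʳ (+-congˡ (-‿cong (sym (Zg≈G x)))))) ⟩
            E (λ x → (f x - Z * g x) * φ x + (Z - 1#) * (g x * φ x))
              ≈⟨ E-cong (λ x → solve 4 (λ f z g p → (f :- z :* g) :* p :+ (z :- # 1) :* (g :* p) := p :* (f :- g)) refl
                   (f x) Z (g x) (φ x)) ⟩
            E (λ x → φ x * (f x - g x))
              ≈⟨ E≈𝔼 _ ⟩
            𝔼 Ω (λ x → φ x * (f x - g x))
              ≈⟨ ∑-cong (λ x → sym (*-assoc (μ x) (φ x) (f x - g x))) ⟩
            ⟪ Ω , φ ⟫ (λ x → f x - g x) ∎

          correlation-within : ⟪ Ω , φ ⟫ (λ x → f x - g x) within η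
          correlation-within = within-resp E-decomposition
            (trans (solve 1 (λ s → # 17 :* s :+ # 1 :* s := # 18 :* s) refl σ) 18σ≈η)
            (within-+ E-[f-G]φ-within (within-* 0≤1 E-gφ-within Z-1-within))

        g-close : dualNorm Ω F (λ x → f x - g x) ≤ η
        g-close = dualNorm≤ {h = λ x → f x - g x} F-inhabited
          λ φ∈F → ∣x∣≤r (proj₁ (correlation-within φ∈F)) (proj₂ (correlation-within φ∈F))

        -- The single factor `y` of `h` accounts for the `suc`, so the degree is positive even for
        -- `n = 0`.
        g-comb : Comb (suc (n ℕ.* 2)) g
        g-comb = comb-scale (<⇒≤ (⁻¹-pos 0<Z)) (comb-scale 0≤r (comb-scale (<⇒≤ 0<c)
          (comb-* y-comb (comb-^ n (comb-+ (comb-const (0≤fromℕ 3)) (comb-* y-comb y-comb))))))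
          where
          y-comb : Comb 1 y
          y-comb = comb-+ (comb-const 0≤a) (cone-comb cone)

  riesz-approximation : (Ω : FiniteProbabilitySpace) (F : Pred (FiniteProbabilitySpace.X Ω → ℝ) 0ℓ) →
    Satisfiable F → SupNormAtMost Ω F 1# →
    (η : ℝ) → 0# < η → η < exp (- fromℕ 3) →
    (f : FiniteProbabilitySpace.X Ω → ℝ) → f ∈ IsDensity Ω →
    ∃[ g ] g ∈ IsDensity Ω ×
      dualNorm Ω F (λ x → f x - g x) ≤ η ×
      (∃[ d ] IsNonNegCombination Ω (IsRieszProduct Ω F d) g ×
        fromℕ d ≤ fromℕ 12 * (Ent Ω f * η ⁻¹)
                    + fromℕ 3 * (log (η ⁻¹) * log (log (η ⁻¹)) ⁻¹))
  riesz-approximation Ω F F-inhabited F-sup η 0<η η<exp[-3] f f-density =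
    g , g-density , g-close , suc (n ℕ.* 2) , comb⇒isNonNegCombination g-comb , degree-bound
    where
    open Expectation Ω using (SupNormAtMost⇒∣φ∣≤)
    open RieszCombinations Ω F F-inhabited using (comb⇒isNonNegCombination)
    module A = Approximation Ω F F-inhabited (SupNormAtMost⇒∣φ∣≤ F-sup)
    E′ : ℝ
    E′ = Ent Ω f * η ⁻¹
    0≤6E′ : 0# ≤ fromℕ 6 * E′
    0≤6E′ = *-nonNeg (0≤fromℕ 6) (*-nonNeg (A.Density.Ent-nonNeg f f-density) (<⇒≤ (⁻¹-pos 0<η)))
    n = proj₁ (ceiling (fromℕ 6 * E′) 0≤6E′)
    6E′≤n = proj₁ (proj₂ (ceiling (fromℕ 6 * E′) 0≤6E′))
    n≤6E′+1 = proj₂ (proj₂ (ceiling (fromℕ 6 * E′) 0≤6E′))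
    η≤1 = ≤-trans (<⇒≤ η<exp[-3]) (<⇒≤ exp[-3]<1)
    open A.Density.Construction f f-density η 0<η η≤1 n 6E′≤n using (g; g-density; g-close; g-comb)
    L = log (η ⁻¹) * log (log (η ⁻¹)) ⁻¹
    -- Rounding up gives `2n + 1 ≤ 2 (6 E′ + 1) + 1 = 12 E′ + 3`, and `3 ≤ 3 L`.
    degree-bound : fromℕ (suc (n ℕ.* 2)) ≤ fromℕ 12 * E′ + fromℕ 3 * L
    degree-bound = ≤-respˡ-≈ (+-congˡ (sym (×1-homo-* n 2))) (≤-by
      (+-nonNeg (*-nonNeg (0≤fromℕ 2) (0≤y-x n≤6E′+1)) (*-nonNeg (0≤fromℕ 3) (0≤y-x (1≤log/loglog 0<η η<exp[-3]))))
      (solve 3 (λ n e l → # 1 :+ n :* # 2 :+ (# 2 :* (# 6 :* e :+ # 1 :- n) :+ # 3 :* (l :- # 1)) := # 12 :* e :+ # 3 :* l)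
        refl (fromℕ n) E′ L))

theorem2p5 : (em : ExcludedMiddle 0ℓ) (reals : CompleteOrderedField) →
    let open Analysis em reals
        open FiniteProbabilitySpace using (X) in
    ∃[ C ] 0# < C ×
      ((Ω : FiniteProbabilitySpace) (F : Pred (X Ω → ℝ) 0ℓ) →
       Satisfiable F →
       SupNormAtMost Ω F 1# →
       (η : ℝ) → 0# < η → η < exp (- fromℕ 3) →
       (f : X Ω → ℝ) → f ∈ IsDensity Ω →
       ∃[ g ] g ∈ IsDensity Ω ×
         dualNorm Ω F (λ x → f x - g x) ≤ η ×
         (∃[ d ] IsNonNegCombination Ω (IsRieszProduct Ω F d) g ×
           fromℕ d ≤ fromℕ 12 * (Ent Ω f * η ⁻¹)
                       + C * (log (η ⁻¹) * log (log (η ⁻¹)) ⁻¹)))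
theorem2p5 em reals = fromℕ 3 , 0<fromℕ 3 , riesz-approximation
  where
  open Analysis em reals using (fromℕ)
  open Regularity em reals using (0<fromℕ; riesz-approximation)
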